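{- Let $v,w\in S_n$. (i) If $v\not\le w$ then $\operatorname{mdeg}_a(P_{v,w})<\kappa_{v,w}$. (ii) If $v\le w$ then $\operatorname{mdeg}_a(P_{v,w})=\kappa_{v,w}$. (iii) For any $v,w\in S_n$, let $P^{\top}_{v,w}(q)$ be obtained from $a^{\kappa_{v,w}}\cdot([a^{\kappa_{v,w}}]P_{v,w})$ by substituting $a:=q^{ -1/2}$, $z:=q^{1/2}-q^{ -1/2}$. Then $R_v^w(q)=(q-1)^{n-1}P^{\top}_{v,w}(q)$.
   Context: $S_n$ has simple transpositions $s_i=(i,i+1)$, length $\ell$ and Bruhat order $\le$; $\ell_{v,w}:=\ell(w)-\ell(v)$ and $\kappa_{v,w}:=n-1-\ell_{v,w}$. The Kazhdan–Lusztig $R$-polynomials $R_v^w(q)$ are determined by: $R_v^w=0$ if $v\not\le w$, $R_v^v=1$, and for $v\le w$ and any simple transposition $s$ with $sw<w$: $R_v^w=R_{sv}^{sw}$ if $sv<v$, and $R_v^w=(q-1)R_{sv}^w+qR_{sv}^{sw}$ if $sv>v$. For $u\in S_n$, $\beta(u)$ is the positive braid obtained from a reduced word of $u$ by $s_i\mapsto\sigma_i$; $\beta_{v,w}:=\beta(w)\beta(v)^{ -1}$ and $P_{v,w}(a,z)$ is the HOMFLY polynomial of its closure, where HOMFLY is normalized by $aP(L_+)-a^{ -1}P(L_-)=zP(L_0)$ and $P(\text{unknot})=1$. For a Laurent polynomial $P(a,z)$, $\operatorname{mdeg}_a(P)$ is the maximal degree of $a$ in $P$ and $[a^\kappa]P$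 is the coefficient of $a^\kappa$. -}

module Defs where

open import Data.Nat as ℕ using (ℕ; zero; suc)
open import Data.Integer as ℤ using (ℤ; +_; -[1+_]; 0ℤ; 1ℤ)
open import Data.Fin as Fin using (Fin; toℕ; inject₁; fromℕ)
open import Data.Vec as Vec using (Vec; lookup; tabulate)
open import Data.List as List using (List; []; _∷_; _++_; map; concatMap; length; reverse; foldr)
open import Data.Product using (_×_; _,_; ∃)
open import Data.Bool using (Bool; true; false; if_then_else_; _∧_)
open import Relation.Nullary using (¬_; does)
open import Relation.Binary.PropositionalEquality using (_≡_; _≢_)
open import Data.Nat.ListAction using () renaming (sum to sumℕ)

-- Laurent polynomials in one variable t over ℤ (q := t², i.e. t = q^{1/2}),
-- represented as formal sums of terms (exponent , coefficient);
-- equality is equality of all coefficients.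

LP1 : Set
LP1 = List (ℤ × ℤ)

coeff1 : LP1 → ℤ → ℤ
coeff1 [] k = 0ℤ
coeff1 ((e , c) ∷ p) k = (if does (e ℤ.≟ k) then c else 0ℤ) ℤ.+ coeff1 p k

infix 4 _≈₁_
_≈₁_ : LP1 → LP1 → Set
p ≈₁ r = ∀ k → coeff1 p k ≡ coeff1 r k

mon1 : ℤ → ℤ → LP1
mon1 e c = (e , c) ∷ []

zero1 one1 : LP1
zero1 = []
one1 = mon1 0ℤ 1ℤ

scale1 : ℤ → LP1 → LP1
scale1 c = map (λ { (e , d) → (e , c ℤ.* d) })

infixl 6 _+₁_
infixl 7 _*₁_
_+₁_ : LP1 → LP1 → LP1
_+₁_ = _++_

_*₁_ : LP1 → LP1 → LP1
p *₁ r = concatMap (λ { (e , c) → map (λ { (f , d) → (e ℤ.+ f , c ℤ.* d) }) r }) p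

pow1 : LP1 → ℕ → LP1
pow1 p zero = one1
pow1 p (suc k) = p *₁ pow1 p k

qvar : LP1
qvar = mon1 (+ 2) 1ℤ

qMinus1 : LP1
qMinus1 = (+ 2 , 1ℤ) ∷ (0ℤ , ℤ.- 1ℤ) ∷ []

uvar : LP1
uvar = (+ 1 , 1ℤ) ∷ (ℤ.- (+ 1) , ℤ.- 1ℤ) ∷ []

-- Laurent polynomials in two variables a, z over ℤ:
-- terms (a-exponent , z-exponent , coefficient).

LP2 : Set
LP2 = List (ℤ × ℤ × ℤ)

coeff2 : LP2 → ℤ → ℤ → ℤ
coeff2 [] i j = 0ℤ
coeff2 ((e , f , c) ∷ p) i j =
  (if does (e ℤ.≟ i) ∧ does (f ℤ.≟ j) then c else 0ℤ) ℤ.+ coeff2 p i j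

infix 4 _≈₂_
_≈₂_ : LP2 → LP2 → Set
p ≈₂ r = ∀ i j → coeff2 p i j ≡ coeff2 r i j

one2 : LP2
one2 = (0ℤ , 0ℤ , 1ℤ) ∷ []

monMul2 : ℤ → ℤ → LP2 → LP2
monMul2 i j = map (λ { (e , f , c) → (e ℤ.+ i , f ℤ.+ j , c) })

neg2 : LP2 → LP2
neg2 = map (λ { (e , f , c) → (e , f , ℤ.- c) })

MdegLt : ℤ → LP2 → Set
MdegLt κ P = ∀ i j → κ ℤ.≤ i → coeff2 P i j ≡ 0ℤ

MdegEq : ℤ → LP2 → Set
MdegEq κ P = (∀ i j → κ ℤ.< i → coeff2 P i j ≡ 0ℤ) × ∃ (λ j → coeff2 P κ j ≢ 0ℤ)

-- Given N, the substitution z := t - t⁻¹ into u^N · [a^κ]P, i.e.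
-- Σ_j c_j (t - t⁻¹)^{j+N} where c_j = [a^κ z^j]P.  Terms with j + N < 0 are
-- dropped; this is only used under the hypothesis that they all vanish.
topSubst : ℕ → ℤ → LP2 → LP1
topSubst N κ = concatMap term
  where
  term : ℤ × ℤ × ℤ → LP1
  term (i , j , c) with does (i ℤ.≟ κ) | j ℤ.+ + N
  ... | true  | + k      = scale1 c (pow1 uvar k)
  ... | true  | -[1+ _ ] = []
  ... | false | _        = []

-- Symmetric group S_n in one-line notation: π ↦ (π(0), …, π(n-1)).

Perm : ℕ → Set
Perm n = Vec (Fin n) n

IsPerm : ∀ {n} → Perm n → Set
IsPerm π = ∀ i j → lookup π i ≡ lookup π j → i ≡ j

idPerm : ∀ n → Perm n
idPerm n = Vec.allFin n

swapF : ∀ {n} → Fin n → Fin n → Fin n → Fin n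
swapF a b k = if does (k Fin.≟ a) then b else (if does (k Fin.≟ b) then a else k)

rightT : ∀ {n} → Fin n → Fin n → Perm n → Perm n
rightT a b π = tabulate (λ k → lookup π (swapF a b k))

sL : ∀ {m} → Fin m → Perm (suc m) → Perm (suc m)
sL i π = Vec.map (swapF (inject₁ i) (Fin.suc i)) π

len : ∀ {n} → Perm n → ℕ
len {n} π = sumℕ (map f (List.cartesianProduct (List.allFin n) (List.allFin n)))
  where
  f : Fin n × Fin n → ℕ
  f (i , j) = if does (toℕ i ℕ.<? toℕ j) ∧ does (toℕ (lookup π j) ℕ.<? toℕ (lookup π i))
              then 1 else 0

infix 4 _≤B_ _<B_
data _≤B_ {n} (v : Perm n) : Perm n → Set where
  ≤B-refl : v ≤B v
  ≤B-step : ∀ {u} (a b : Fin n) → a ≢ b → v ≤B u →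
            len u ℕ.< len (rightT a b u) → v ≤B rightT a b u

_<B_ : ∀ {n} → Perm n → Perm n → Set
v <B w = v ≤B w × v ≢ w

wordPerm : ∀ {m} → List (Fin m) → Perm (suc m)
wordPerm {m} = foldr sL (idPerm (suc m))

IsReducedWord : ∀ {m} → Perm (suc m) → List (Fin m) → Set
IsReducedWord u ws = wordPerm ws ≡ u × length ws ≡ len u

ℓvw : ∀ {n} → Perm n → Perm n → ℤ
ℓvw v w = + len w ℤ.- + len v

-- κ_{v,w} = n - 1 - ℓ_{v,w}, with n = m + 1
kappa : ∀ {m} → Perm (suc m) → Perm (suc m) → ℤ
kappa {m} v w = + m ℤ.- ℓvw v w

-- Kazhdan–Lusztig R-polynomials on S_{m+1} (values in ℤ[q] ⊂ ℤ[t^{±1}], q = t²):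
-- the defining recursion.

record IsRPoly (m : ℕ) (R : Perm (suc m) → Perm (suc m) → LP1) : Set where
  field
    R-notle : ∀ v w → IsPerm v → IsPerm w → ¬ (v ≤B w) → R v w ≈₁ zero1
    R-diag  : ∀ v → IsPerm v → R v v ≈₁ one1
    R-desc  : ∀ v w i → IsPerm v → IsPerm w → v ≤B w → sL i w <B w →
              sL i v <B v → R v w ≈₁ R (sL i v) (sL i w)
    R-asc   : ∀ v w i → IsPerm v → IsPerm w → v ≤B w → sL i w <B w →
              v <B sL i v →
              R v w ≈₁ qMinus1 *₁ R (sL i v) w +₁ qvar *₁ R (sL i v) (sL i w)

-- Braid words on m+1 strands: σ⁺ i = σ_i, σ⁻ i = σ_i⁻¹ (i : Fin m).

data Gen (m : ℕ) : Set where
  σ⁺ σ⁻ : Fin m → Gen m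

liftG : ∀ {m} → Gen m → Gen (suc m)
liftG (σ⁺ i) = σ⁺ (inject₁ i)
liftG (σ⁻ i) = σ⁻ (inject₁ i)

posBraid : ∀ {m} → List (Fin m) → List (Gen m)
posBraid = map σ⁺

invPosBraid : ∀ {m} → List (Fin m) → List (Gen m)
invPosBraid ws = reverse (map σ⁻ ws)

βvw : ∀ {m} → List (Fin m) → List (Fin m) → List (Gen m)
βvw rv rw = posBraid rw ++ invPosBraid rv

-- HOMFLY polynomial of braid closures: F m β = P(closure of β), β on m+1 strands.
-- Axioms: invariance under the braid group relations, conjugation and Markov
-- stabilisation (so F is a link invariant by Markov's theorem), the skein relation
-- a P(L₊) - a⁻¹ P(L₋) = z P(L₀) and P(unknot) = 1.  These determine F uniquely.

record IsHOMFLY (F : (m : ℕ) → List (Gen m) → LP2) : Set where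
  field
    cancel⁺⁻ : ∀ m x y i → F m (x ++ σ⁺ i ∷ σ⁻ i ∷ y) ≈₂ F m (x ++ y)
    cancel⁻⁺ : ∀ m x y i → F m (x ++ σ⁻ i ∷ σ⁺ i ∷ y) ≈₂ F m (x ++ y)
    far      : ∀ m x y (i j : Fin m) → suc (toℕ i) ℕ.< toℕ j →
               F m (x ++ σ⁺ i ∷ σ⁺ j ∷ y) ≈₂ F m (x ++ σ⁺ j ∷ σ⁺ i ∷ y)
    braid    : ∀ m x y (i j : Fin m) → toℕ j ≡ suc (toℕ i) →
               F m (x ++ σ⁺ i ∷ σ⁺ j ∷ σ⁺ i ∷ y) ≈₂ F m (x ++ σ⁺ j ∷ σ⁺ i ∷ σ⁺ j ∷ y)
    conj     : ∀ m x y → F m (x ++ y) ≈₂ F m (y ++ x)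
    stab⁺    : ∀ m x → F (suc m) (map liftG x ++ σ⁺ (fromℕ m) ∷ []) ≈₂ F m x
    stab⁻    : ∀ m x → F (suc m) (map liftG x ++ σ⁻ (fromℕ m) ∷ []) ≈₂ F m x
    skein    : ∀ m x y i →
               monMul2 (+ 1) 0ℤ (F m (x ++ σ⁺ i ∷ y))
                 ++ neg2 (monMul2 (ℤ.- (+ 1)) 0ℤ (F m (x ++ σ⁻ i ∷ y)))
               ≈₂ monMul2 0ℤ (+ 1) (F m (x ++ y))
    unknot   : F 0 [] ≈₂ one2

{-# OPTIONS --safe #-}
module Submission where

-- Write w = s w′ with w′ < w and let T_{v,w} = [a^κ] P_{v,w}. If sv < v, then σ_s cancels up to conjugation and
-- T_{v,w} = T_{sv,w′}; if sv > v, the skein relation gives T_{v,w} = z T_{v,w′} + T_{sv,w′}. With a = q^{-1/2} and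
-- z = q^{1/2} - q^{-1/2} this is the recursion of the R-polynomials, and since no signs occur T_{v,w} ≠ 0 whenever
-- v ≤ w. For w = 1 one needs the Morton–Franks–Williams bound for the inverse of a permutation braid: if the last
-- generator occurs in its normal form it occurs once, and removing it by a negative stabilisation lowers the bound by 2.

open import Defs
open import Algebra.Bundles using (CommutativeMonoid)
import Algebra.Properties.CommutativeSemigroup as CommutativeSemigroupP
open import Data.Nat as ℕ using (ℕ; zero; suc; z≤n; s≤s)
import Data.Nat.Properties as ℕP
open import Data.Nat.ListAction using () renaming (sum to sumℕ)
open import Data.Integer as ℤ using (ℤ; +_; -[1+_]; 0ℤ; 1ℤ; _+_; _<_; -_)
import Data.Integer.Properties as ℤP
open import Data.Integer.Tactic.RingSolver using (solve-∀)
open import Data.Fin as Fin using (Fin; toℕ; inject₁; fromℕ; punchOut)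
import Data.Fin.Properties as FinP
open import Data.Fin.Relation.Unary.Top using (view; ‵fromℕ; ‵inject₁)
open import Data.Vec as Vec using (lookup)
import Data.Vec.Properties as VecP
open import Data.List as List using (List; []; _∷_; _++_; map; length; reverse; concatMap)
import Data.List.Properties as ListP
open import Data.List.Membership.Propositional using (_∈_)
open import Data.List.Membership.Propositional.Properties using (∈-cartesianProduct⁺; ∈-allFin)
open import Data.List.Relation.Unary.Any using (here; there)
open import Data.List.Relation.Unary.All as All using ()
open import Data.List.Relation.Unary.AllPairs using (_∷_)
open import Data.List.Relation.Unary.Unique.Propositional using (Unique)
import Data.List.Relation.Unary.Unique.Propositional.Properties as UniqueP
open import Data.Product using (_×_; _,_; ∃; proj₁; proj₂)
open import Data.Sum using (_⊎_; inj₁; inj₂)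
open import Data.Bool using (true; false; if_then_else_; _∧_)
open import Function using (_∘_; id)
open import Function.Bundles using (mk⇔; _⇔_)
open import Relation.Nullary using (¬_; yes; no; does; contradiction)
open import Relation.Nullary.Decidable using (dec-true; dec-false; does-⇔)
open import Relation.Binary.Definitions using (tri<; tri≈; tri>)
open import Relation.Binary.PropositionalEquality
import Relation.Binary.Reasoning.Setoid as SetoidReasoning

-- Transpositions, length and Bruhat order

-- Why inverses of permutation braids: every spanning braid other than the trivial one must have
-- zero top coefficient, as R_v^1 = 0 for v ≠ 1. A negative stabilisation leaves a margin of 2 below
-- the bound and forces this; a positive one leaves no margin. The bound has to be proved for all
-- braids at once: deleting the last generator from the inverse of a permutation braid leaves a
-- product of two such inverses, to which only a statement about arbitrary braids on fewer strands
-- applies. Top coefficients are kept as lists of exponents. The recursion only shifts and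
-- concatenates lists, so nothing can cancel, nonvanishing is nonemptiness, and R is a second
-- evaluation of the same list. Permutations enter through normal forms, for which s_i u > u or s_i
-- u < u is witnessed by braid relations between words; such a witness acts on braids and on
-- permutations alike.

swap-view : ∀ {n} (a b k : Fin n) →
  (k ≡ a × swapF a b k ≡ b) ⊎ (k ≢ a × k ≡ b × swapF a b k ≡ a) ⊎ (k ≢ a × k ≢ b × swapF a b k ≡ k)
swap-view a b k with k Fin.≟ a
... | yes p = inj₁ (p , refl)
... | no p with k Fin.≟ b
...   | yes q = inj₂ (inj₁ (p , q , refl))
...   | no q = inj₂ (inj₂ (p , q , refl))

swap-left : ∀ {n} (a b : Fin n) → swapF a b a ≡ b
swap-left a b with swap-view a b a
... | inj₁ (_ , e) = e
... | inj₂ (inj₁ (p , _)) = contradiction refl p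
... | inj₂ (inj₂ (p , _)) = contradiction refl p

swap-right : ∀ {n} (a b : Fin n) → swapF a b b ≡ a
swap-right a b with swap-view a b b
... | inj₁ (p , e) = trans e p
... | inj₂ (inj₁ (_ , _ , e)) = e
... | inj₂ (inj₂ (_ , p , _)) = contradiction refl p

swap-other : ∀ {n} {a b k : Fin n} → k ≢ a → k ≢ b → swapF a b k ≡ k
swap-other {a = a} {b} {k} p q with swap-view a b k
... | inj₁ (p′ , _) = contradiction p′ p
... | inj₂ (inj₁ (_ , q′ , _)) = contradiction q′ q
... | inj₂ (inj₂ (_ , _ , e)) = e

swap-comm : ∀ {n} (a b k : Fin n) → swapF a b k ≡ swapF b a k
swap-comm a b k with swap-view a b k
... | inj₁ (refl , e) = trans e (sym (swap-right b a))
... | inj₂ (inj₁ (_ , refl , e)) = trans e (sym (swap-left b a))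
... | inj₂ (inj₂ (p , q , e)) = trans e (sym (swap-other q p))

swap-involutive : ∀ {n} (a b k : Fin n) → swapF a b (swapF a b k) ≡ k
swap-involutive a b k with swap-view a b k
... | inj₁ (refl , e) = trans (cong (swapF a b) e) (swap-right a b)
... | inj₂ (inj₁ (_ , refl , e)) = trans (cong (swapF a b) e) (swap-left a b)
... | inj₂ (inj₂ (_ , _ , e)) = trans (cong (swapF a b) e) e

swap-injective : ∀ {n} (a b : Fin n) {k l} → swapF a b k ≡ swapF a b l → k ≡ l
swap-injective a b {k} {l} e =
  trans (sym (swap-involutive a b k)) (trans (cong (swapF a b) e) (swap-involutive a b l))

swap-natural : ∀ {n m} (f : Fin n → Fin m) → (∀ i j → f i ≡ f j → i ≡ j) →
  ∀ a b k → f (swapF a b k) ≡ swapF (f a) (f b) (f k)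
swap-natural f inj a b k with swap-view a b k
... | inj₁ (refl , e) = trans (cong f e) (sym (swap-left (f a) (f b)))
... | inj₂ (inj₁ (_ , refl , e)) = trans (cong f e) (sym (swap-right (f a) (f b)))
... | inj₂ (inj₂ (p , q , e)) = trans (cong f e) (sym (swap-other (p ∘ inj k a) (q ∘ inj k b)))

lookup-ext : ∀ {n} {u v : Perm n} → (∀ k → lookup u k ≡ lookup v k) → u ≡ v
lookup-ext {u = u} {v} h =
  trans (sym (VecP.tabulate∘lookup u)) (trans (VecP.tabulate-cong h) (VecP.tabulate∘lookup v))

swapValues : ∀ {n} → Fin n → Fin n → Perm n → Perm n
swapValues x y = Vec.map (swapF x y)

lookup-swapValues : ∀ {n} (x y : Fin n) π k → lookup (swapValues x y π) k ≡ swapF x y (lookup π k)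
lookup-swapValues x y π k = VecP.lookup-map k (swapF x y) π

lookup-rightT : ∀ {n} (a b : Fin n) π k → lookup (rightT a b π) k ≡ lookup π (swapF a b k)
lookup-rightT a b π k = VecP.lookup∘tabulate _ k

-- A wrapper from which Agda can infer π (IsPerm π unfolds to a function type).
record Permutation {n} (π : Perm n) : Set where
  constructor permutation
  field distinct : IsPerm π

open Permutation

idPerm-Permutation : ∀ n → Permutation (idPerm n)
idPerm-Permutation n .distinct i j e = trans (sym (VecP.lookup-allFin i)) (trans e (VecP.lookup-allFin j))

swapValues-Permutation : ∀ {n} (x y : Fin n) {π} → Permutation π → Permutation (swapValues x y π)
swapValues-Permutation x y {π} h .distinct i j e =
  h .distinct i j (swap-injective x y (trans (sym (lookup-swapValues x y π i)) (trans e (lookup-swapValues x y π j))))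

rightT-Permutation : ∀ {n} (a b : Fin n) {π} → Permutation π → Permutation (rightT a b π)
rightT-Permutation a b {π} h .distinct i j e =
  swap-injective a b (h .distinct _ _ (trans (sym (lookup-rightT a b π i)) (trans e (lookup-rightT a b π j))))

swapValues-involutive : ∀ {n} (x y : Fin n) π → swapValues x y (swapValues x y π) ≡ π
swapValues-involutive x y π = lookup-ext λ k →
  trans (lookup-swapValues x y (swapValues x y π) k)
    (trans (cong (swapF x y) (lookup-swapValues x y π k)) (swap-involutive x y _))

swapValues-comm : ∀ {n} (x y : Fin n) π → swapValues x y π ≡ swapValues y x π
swapValues-comm x y π = VecP.map-cong (swap-comm x y) π

rightT-involutive : ∀ {n} (a b : Fin n) π → rightT a b (rightT a b π) ≡ π
rightT-involutive a b π = lookup-ext λ k →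
  trans (lookup-rightT a b (rightT a b π) k)
    (trans (lookup-rightT a b π _) (cong (lookup π) (swap-involutive a b k)))

rightT-swapValues : ∀ {n} (a b : Fin n) {π} → Permutation π →
  rightT a b π ≡ swapValues (lookup π a) (lookup π b) π
rightT-swapValues a b {π} h = lookup-ext λ k →
  trans (lookup-rightT a b π k)
    (trans (swap-natural (lookup π) (h .distinct) a b k) (sym (lookup-swapValues (lookup π a) (lookup π b) π k)))

rightT-swapValues-commute : ∀ {n} (a b x y : Fin n) π →
  swapValues x y (rightT a b π) ≡ rightT a b (swapValues x y π)
rightT-swapValues-commute a b x y π = lookup-ext λ k →
  trans (lookup-swapValues x y (rightT a b π) k)
    (trans (cong (swapF x y) (lookup-rightT a b π k))
      (sym (trans (lookup-rightT a b (swapValues x y π) k) (lookup-swapValues x y π _))))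

-- Pigeonhole: if `x` were missed, punching it out of the values would inject `Fin (suc n)` into
-- `Fin n`.
Permutation-surjective : ∀ {n} {π : Perm n} → Permutation π → ∀ x → ∃ λ p → lookup π p ≡ x
Permutation-surjective {zero} _ ()
Permutation-surjective {suc n} {π} h x with FinP.any? (λ p → lookup π p Fin.≟ x)
... | yes r = r
... | no r = contradiction
  (FinP.injective⇒≤ {f = λ p → punchOut (miss p)}
    (λ {i} {j} e → h .distinct i j (FinP.punchOut-injective (miss i) (miss j) e)))
  ℕP.1+n≰n
  where
  miss : ∀ p → x ≢ lookup π p
  miss p e = r (p , sym e)

-- Left multiplication by simple transpositions and its effect on length

sL-Permutation : ∀ {m} (i : Fin m) {π} → Permutation π → Permutation (sL i π)
sL-Permutation i = swapValues-Permutation (inject₁ i) (Fin.suc i)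

sL-involutive : ∀ {m} (i : Fin m) π → sL i (sL i π) ≡ π
sL-involutive i = swapValues-involutive (inject₁ i) (Fin.suc i)

lookup-sL : ∀ {m} (i : Fin m) π k → lookup (sL i π) k ≡ swapF (inject₁ i) (Fin.suc i) (lookup π k)
lookup-sL i = lookup-swapValues (inject₁ i) (Fin.suc i)

wordPerm-Permutation : ∀ {m} (ws : List (Fin m)) → Permutation (wordPerm ws)
wordPerm-Permutation [] = idPerm-Permutation _
wordPerm-Permutation (i ∷ ws) = sL-Permutation i (wordPerm-Permutation ws)

-- No third value lies between i and i + 1, so exchanging them reverses the order of that one pair
-- only.
adjacent-swap-mono : ∀ {m} (i : Fin m) {x y} → x Fin.< y → ¬ (x ≡ inject₁ i × y ≡ Fin.suc i) →
  swapF (inject₁ i) (Fin.suc i) x Fin.< swapF (inject₁ i) (Fin.suc i) y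
adjacent-swap-mono i {x} {y} x<y not
  with swap-view (inject₁ i) (Fin.suc i) x | swap-view (inject₁ i) (Fin.suc i) y
... | inj₁ (refl , e) | inj₁ (refl , e′) = contradiction x<y (ℕP.<-irrefl refl)
... | inj₁ (refl , e) | inj₂ (inj₁ (_ , refl , e′)) = contradiction (refl , refl) not
... | inj₁ (refl , e) | inj₂ (inj₂ (p , q , e′)) rewrite e | e′ =
      ℕP.≤∧≢⇒< (subst (λ z → suc z ℕ.≤ toℕ y) (FinP.toℕ-inject₁ i) x<y) (λ r → q (FinP.toℕ-injective (sym r)))
... | inj₂ (inj₁ (_ , refl , e)) | inj₁ (refl , e′) =
      contradiction (ℕP.<-trans x<y (s≤s (ℕP.≤-reflexive (FinP.toℕ-inject₁ i)))) (ℕP.<-irrefl refl)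
... | inj₂ (inj₁ (_ , refl , e)) | inj₂ (inj₁ (_ , refl , e′)) = contradiction x<y (ℕP.<-irrefl refl)
... | inj₂ (inj₁ (_ , refl , e)) | inj₂ (inj₂ (p , q , e′)) rewrite e | e′ | FinP.toℕ-inject₁ i =
      ℕP.<-trans (ℕP.n<1+n _) x<y
... | inj₂ (inj₂ (_ , _ , e)) | inj₁ (refl , e′) rewrite e | e′ =
      ℕP.<-trans x<y (s≤s (ℕP.≤-reflexive (FinP.toℕ-inject₁ i)))
... | inj₂ (inj₂ (p , q , e)) | inj₂ (inj₁ (_ , refl , e′)) rewrite e | e′ | FinP.toℕ-inject₁ i =
      ℕP.≤∧≢⇒< (ℕP.≤-pred x<y) (λ r → p (FinP.toℕ-injective (trans r (sym (FinP.toℕ-inject₁ i)))))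
... | inj₂ (inj₂ (_ , _ , e)) | inj₂ (inj₂ (_ , _ , e′)) rewrite e | e′ = x<y

sum-map-cong : ∀ {A : Set} {f g : A → ℕ} (L : List A) → (∀ y → y ∈ L → f y ≡ g y) →
  sumℕ (map f L) ≡ sumℕ (map g L)
sum-map-cong [] h = refl
sum-map-cong (x ∷ L) h = cong₂ ℕ._+_ (h x (here refl)) (sum-map-cong L (λ y → h y ∘ there))

sum-map-suc-at : ∀ {A : Set} {f g : A → ℕ} {x} (L : List A) → Unique L → x ∈ L → f x ≡ suc (g x) →
  (∀ y → y ≢ x → f y ≡ g y) → sumℕ (map f L) ≡ suc (sumℕ (map g L))
sum-map-suc-at (y ∷ L) (y∉ ∷ _) (here refl) fx h =
  cong₂ ℕ._+_ fx (sum-map-cong L (λ z z∈ → h z (λ z≡y → All.lookup y∉ z∈ (sym z≡y))))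
sum-map-suc-at {g = g} {x} (y ∷ L) (y∉ ∷ u) (there x∈) fx h =
  trans (cong₂ ℕ._+_ (h y (All.lookup y∉ x∈)) (sum-map-suc-at L u x∈ fx h)) (ℕP.+-suc (g y) _)

pairs-Unique : ∀ n → Unique (List.cartesianProduct (List.allFin n) (List.allFin n))
pairs-Unique n = UniqueP.cartesianProduct⁺ (UniqueP.allFin⁺ n) (UniqueP.allFin⁺ n)

-- Only the values i and i + 1 change their relative order, so exactly one summand of the length
-- changes, the one of `(p , q)`.
len-sL-up : ∀ {m} (i : Fin m) {π} → Permutation π → ∀ {p q} → lookup π p ≡ inject₁ i → lookup π q ≡ Fin.suc i →
  p Fin.< q → len (sL i π) ≡ suc (len π)
len-sL-up {m} i {π} h {p} {q} πp πq p<q =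
  sum-map-suc-at _ (pairs-Unique (suc m)) (∈-cartesianProduct⁺ (∈-allFin p) (∈-allFin q)) here′ away
  where
  s = swapF (inject₁ i) (Fin.suc i)
  i<si : inject₁ i Fin.< Fin.suc i
  i<si = s≤s (ℕP.≤-reflexive (FinP.toℕ-inject₁ i))
  here′ : (if does (toℕ p ℕ.<? toℕ q) ∧ does (toℕ (lookup (sL i π) q) ℕ.<? toℕ (lookup (sL i π) p)) then 1 else 0)
    ≡ suc (if does (toℕ p ℕ.<? toℕ q) ∧ does (toℕ (lookup π q) ℕ.<? toℕ (lookup π p)) then 1 else 0)
  here′ rewrite lookup-sL i π q | lookup-sL i π p | πp | πq
    | swap-left (inject₁ i) (Fin.suc i) | swap-right (inject₁ i) (Fin.suc i)
    | dec-true (toℕ p ℕ.<? toℕ q) p<q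
    | dec-true (toℕ (inject₁ i) ℕ.<? suc (toℕ i)) i<si
    | dec-false (suc (toℕ i) ℕ.<? toℕ (inject₁ i)) (ℕP.<-asym i<si) = refl
  away : ∀ y → y ≢ (p , q) →
    (if does (toℕ (proj₁ y) ℕ.<? toℕ (proj₂ y)) ∧ does (toℕ (lookup (sL i π) (proj₂ y)) ℕ.<? toℕ (lookup (sL i π) (proj₁ y))) then 1 else 0)
    ≡ (if does (toℕ (proj₁ y) ℕ.<? toℕ (proj₂ y)) ∧ does (toℕ (lookup π (proj₂ y)) ℕ.<? toℕ (lookup π (proj₁ y))) then 1 else 0)
  away (a , b) ne with FinP.<-cmp a b
  ... | tri≈ a≮b _ _ rewrite dec-false (toℕ a ℕ.<? toℕ b) a≮b = refl
  ... | tri> a≮b _ _ rewrite dec-false (toℕ a ℕ.<? toℕ b) a≮b = refl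
  ... | tri< a<b _ _ = cong (λ z → if does (toℕ a ℕ.<? toℕ b) ∧ z then 1 else 0)
    (does-⇔ (mk⇔ to from) (toℕ (lookup (sL i π) b) ℕ.<? toℕ (lookup (sL i π) a)) (toℕ (lookup π b) ℕ.<? toℕ (lookup π a)))
    where
    to : lookup (sL i π) b Fin.< lookup (sL i π) a → lookup π b Fin.< lookup π a
    to l = subst₂ Fin._<_ (back b) (back a) (adjacent-swap-mono i l bad)
      where
      back : ∀ k → s (lookup (sL i π) k) ≡ lookup π k
      back k = trans (cong s (lookup-sL i π k)) (swap-involutive (inject₁ i) (Fin.suc i) _)
      -- Undoing the swap, this would put i at `a` and i + 1 at `b`, hence `(a , b)` would be the
      -- excluded pair.
      bad : ¬ (lookup (sL i π) b ≡ inject₁ i × lookup (sL i π) a ≡ Fin.suc i)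
      bad (eb , ea) = ne (cong₂ _,_
        (h .distinct a p (trans (sym (back a)) (trans (cong s ea) (trans (swap-right (inject₁ i) (Fin.suc i)) (sym πp)))))
        (h .distinct b q (trans (sym (back b)) (trans (cong s eb) (trans (swap-left (inject₁ i) (Fin.suc i)) (sym πq))))))
    from : lookup π b Fin.< lookup π a → lookup (sL i π) b Fin.< lookup (sL i π) a
    from l = subst₂ Fin._<_ (sym (lookup-sL i π b)) (sym (lookup-sL i π a)) (adjacent-swap-mono i l bad)
      where
      bad : ¬ (lookup π b ≡ inject₁ i × lookup π a ≡ Fin.suc i)
      bad (eb , ea) = ℕP.<-asym p<q
        (subst₂ Fin._<_ (h .distinct a q (trans ea (sym πq))) (h .distinct b p (trans eb (sym πp))) a<b)

len-sL-down : ∀ {m} (i : Fin m) {π} → Permutation π → ∀ {p q} → lookup π p ≡ inject₁ i → lookup π q ≡ Fin.suc i →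
  q Fin.< p → len π ≡ suc (len (sL i π))
len-sL-down i {π} h {p} {q} πp πq q<p =
  trans (cong len (sym (sL-involutive i π)))
    (len-sL-up i (sL-Permutation i h)
      (trans (lookup-sL i π q) (trans (cong (swapF (inject₁ i) (Fin.suc i)) πq) (swap-right (inject₁ i) (Fin.suc i))))
      (trans (lookup-sL i π p) (trans (cong (swapF (inject₁ i) (Fin.suc i)) πp) (swap-left (inject₁ i) (Fin.suc i))))
      q<p)

inject₁≢suc : ∀ {m} (i : Fin m) → inject₁ i ≢ Fin.suc i
inject₁≢suc i e = ℕP.1+n≢n (sym (trans (sym (FinP.toℕ-inject₁ i)) (cong toℕ e)))

len-sL-cases : ∀ {m} (i : Fin m) {π} → Permutation π →
  len (sL i π) ≡ suc (len π) ⊎ len π ≡ suc (len (sL i π))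
len-sL-cases i h with Permutation-surjective h (inject₁ i) | Permutation-surjective h (Fin.suc i)
... | p , πp | q , πq with FinP.<-cmp p q
...   | tri< p<q _ _ = inj₁ (len-sL-up i h πp πq p<q)
...   | tri≈ _ refl _ = contradiction (trans (sym πp) πq) (inject₁≢suc i)
...   | tri> _ _ q<p = inj₂ (len-sL-down i h πp πq q<p)

len-sL-≤ : ∀ {m} (i : Fin m) {π} → Permutation π → len (sL i π) ℕ.≤ suc (len π)
len-sL-≤ i {π} h with len-sL-cases i h
... | inj₁ e = ℕP.≤-reflexive e
... | inj₂ e = subst (len (sL i π) ℕ.≤_) (cong suc (sym e)) (ℕP.m≤n⇒m≤1+n (ℕP.n≤1+n _))

-- Induction on `d`, the number of values strictly between x and y, by the conjugation (x y) = s_i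
-- (x₁ y) s_i with x₁ = x + 1. The induction hypothesis compares `π₁` with `σ`; the two outer
-- factors s_i change lengths by one each.
len-swapValues : ∀ {m} d {π : Perm (suc m)} → Permutation π → ∀ {x y p q} → lookup π p ≡ x → lookup π q ≡ y →
  p Fin.< q → toℕ y ≡ suc (d ℕ.+ toℕ x) → len π ℕ.< len (swapValues x y π)
len-swapValues zero h {x} {Fin.suc i} πp πq p<q gap
  with refl ← FinP.toℕ-injective {i = x} {inject₁ i}
         (trans (sym (ℕP.suc-injective gap)) (sym (FinP.toℕ-inject₁ i)))
  = ℕP.≤-reflexive (sym (len-sL-up i h πp πq p<q))
len-swapValues {m} (suc d) {π} h {x} {y} {p} {q} πp πq p<q gap = subst (λ z → len π ℕ.< len z) (sym conjugate) bound
  where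
  x<y : toℕ x ℕ.< toℕ y
  x<y = subst (toℕ x ℕ.<_) (sym gap) (s≤s (ℕP.m≤n+m _ _))
  x<m : toℕ x ℕ.< m
  x<m = ℕP.≤-trans x<y (ℕP.≤-pred (FinP.toℕ<n y))
  i : Fin m
  i = Fin.fromℕ< x<m
  x≡ : inject₁ i ≡ x
  x≡ = FinP.toℕ-injective (trans (FinP.toℕ-inject₁ i) (FinP.toℕ-fromℕ< x<m))
  x₁ = Fin.suc i
  s = swapF (inject₁ i) x₁
  s-x : s x ≡ x₁
  s-x = trans (cong s (sym x≡)) (swap-left (inject₁ i) x₁)
  s-x₁ : s x₁ ≡ x
  s-x₁ = trans (swap-right (inject₁ i) x₁) x≡
  toℕ-x₁ : toℕ x₁ ≡ suc (toℕ x)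
  toℕ-x₁ = cong suc (FinP.toℕ-fromℕ< x<m)
  x≢y : x ≢ y
  x≢y refl = ℕP.<-irrefl refl x<y
  x≢x₁ : x ≢ x₁
  x≢x₁ e = ℕP.1+n≢n (trans (sym toℕ-x₁) (cong toℕ (sym e)))
  y≢x₁ : y ≢ x₁
  y≢x₁ e = ℕP.m≢1+n+m (toℕ x) (ℕP.suc-injective (trans (sym toℕ-x₁) (trans (cong toℕ (sym e)) gap)))
  s-y : s y ≡ y
  s-y = swap-other (λ e → x≢y (sym (trans e x≡))) y≢x₁
  π₁ = sL i π
  σ = swapValues x₁ y π₁
  π₁-perm : Permutation π₁
  π₁-perm = sL-Permutation i h
  σ-perm : Permutation σ
  σ-perm = swapValues-Permutation x₁ y π₁-perm
  π₁-at : ∀ {k z} → lookup π k ≡ z → lookup π₁ k ≡ s z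
  π₁-at {k} e = trans (lookup-sL i π k) (cong s e)
  σ-at : ∀ {k z} → lookup π k ≡ z → lookup σ k ≡ swapF x₁ y (s z)
  σ-at {k} e = trans (lookup-swapValues x₁ y π₁ k) (cong (swapF x₁ y) (π₁-at e))
  ih : len π₁ ℕ.< len σ
  ih = len-swapValues d π₁-perm (trans (π₁-at πp) s-x) (trans (π₁-at πq) s-y) p<q
         (trans gap (cong suc (trans (sym (ℕP.+-suc d (toℕ x))) (cong (d ℕ.+_) (sym toℕ-x₁)))))
  conjugate : swapValues x y π ≡ sL i σ
  conjugate = lookup-ext λ k → trans (lookup-swapValues x y π k) (sym (trans (lookup-sL i σ k)
    (trans (cong s (σ-at refl))
      (trans (swap-natural s (λ _ _ → swap-injective (inject₁ i) x₁) x₁ y (s (lookup π k)))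
        (trans (cong (swapF (s x₁) (s y)) (swap-involutive (inject₁ i) x₁ (lookup π k)))
          (cong₂ (λ a b → swapF a b (lookup π k)) s-x₁ s-y))))))
  bound : len π ℕ.< len (sL i σ)
  -- `r` is the position of the value x₁. If it is right of `p`, the first s_i gains one and the
  -- last loses at most one; if it is left of `p`, the first loses one and the last regains it.
  bound with Permutation-surjective h x₁
  ... | r , πr with FinP.<-cmp p r
  ...   | tri≈ _ refl _ = contradiction (trans (sym πp) πr) x≢x₁
  ...   | tri< p<r _ _ = ℕP.≤-pred (begin
            suc (suc (len π)) ≡⟨ cong suc (sym (len-sL-up i h (trans πp (sym x≡)) πr p<r)) ⟩
            suc (len π₁)      ≤⟨ ih ⟩
            len σ             ≡⟨ cong len (sym (sL-involutive i σ)) ⟩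
            len (sL i (sL i σ)) ≤⟨ len-sL-≤ i (sL-Permutation i σ-perm) ⟩
            suc (len (sL i σ)) ∎)
    where open ℕP.≤-Reasoning
  ...   | tri> _ _ r<p = begin
            suc (len π)        ≡⟨ cong suc (len-sL-down i h (trans πp (sym x≡)) πr r<p) ⟩
            suc (suc (len π₁)) ≤⟨ s≤s ih ⟩
            suc (len σ)        ≡⟨ sym (len-sL-up i σ-perm σr σq (ℕP.<-trans r<p p<q)) ⟩
            len (sL i σ)       ∎
    where
    open ℕP.≤-Reasoning
    σr : lookup σ r ≡ inject₁ i
    σr = trans (σ-at πr) (trans (cong (swapF x₁ y) s-x₁) (trans (swap-other x≢x₁ x≢y) (sym x≡)))
    σq : lookup σ q ≡ x₁
    σq = trans (σ-at πq) (trans (cong (swapF x₁ y) s-y) (swap-right x₁ y))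

-- Symmetric in `a` and `b`, because `≤B-step` does not order its two positions.
Ascent : ∀ {n} → Fin n → Fin n → Perm n → Set
Ascent a b π = (a Fin.< b × lookup π a Fin.< lookup π b) ⊎ (b Fin.< a × lookup π b Fin.< lookup π a)

len-rightT-ascent : ∀ {m} {π : Perm (suc m)} → Permutation π → ∀ {a b} → Ascent a b π → len π ℕ.< len (rightT a b π)
len-rightT-ascent {π = π} h {a} {b} (inj₁ (a<b , lt)) =
  subst (λ z → len π ℕ.< len z) (sym (rightT-swapValues a b h))
    (len-swapValues (toℕ (lookup π b) ℕ.∸ suc (toℕ (lookup π a))) h refl refl a<b
      (trans (sym (ℕP.m∸n+n≡m lt)) (ℕP.+-suc _ _)))
len-rightT-ascent {π = π} h {a} {b} (inj₂ (b<a , lt)) =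
  subst (λ z → len π ℕ.< len z)
    (trans (swapValues-comm _ _ π) (sym (rightT-swapValues a b h)))
    (len-swapValues (toℕ (lookup π a) ℕ.∸ suc (toℕ (lookup π b))) h refl refl b<a
      (trans (sym (ℕP.m∸n+n≡m lt)) (ℕP.+-suc _ _)))

ascent-or-swapped : ∀ {n} {π : Perm n} → Permutation π → ∀ {a b} → a ≢ b → Ascent a b π ⊎ Ascent a b (rightT a b π)
ascent-or-swapped {π = π} h {a} {b} a≢b with FinP.<-cmp a b | FinP.<-cmp (lookup π a) (lookup π b)
... | tri≈ _ e _ | _ = contradiction e a≢b
... | tri< _ _ _ | tri≈ _ e _ = contradiction (h .distinct a b e) a≢b
... | tri> _ _ _ | tri≈ _ e _ = contradiction (h .distinct a b e) a≢b
... | tri< a<b _ _ | tri< lt _ _ = inj₁ (inj₁ (a<b , lt))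
... | tri> _ _ b<a | tri> _ _ lt = inj₁ (inj₂ (b<a , lt))
... | tri< a<b _ _ | tri> _ _ lt = inj₂ (inj₁ (a<b , subst₂ Fin._<_
        (sym (trans (lookup-rightT a b π a) (cong (lookup π) (swap-left a b))))
        (sym (trans (lookup-rightT a b π b) (cong (lookup π) (swap-right a b)))) lt))
... | tri> _ _ b<a | tri< lt _ _ = inj₂ (inj₂ (b<a , subst₂ Fin._<_
        (sym (trans (lookup-rightT a b π b) (cong (lookup π) (swap-right a b))))
        (sym (trans (lookup-rightT a b π a) (cong (lookup π) (swap-left a b)))) lt))

-- A pair that is not an ascent becomes one after the swap, and then swapping back would raise the
-- length.
len-increase⇒ascent : ∀ {m} {π : Perm (suc m)} → Permutation π → ∀ {a b} → a ≢ b →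
  len π ℕ.< len (rightT a b π) → Ascent a b π
len-increase⇒ascent {π = π} h {a} {b} a≢b lt with ascent-or-swapped h a≢b
... | inj₁ asc = asc
... | inj₂ asc = contradiction lt (ℕP.<-asym (subst (λ z → len (rightT a b π) ℕ.< len z)
                   (rightT-involutive a b π) (len-rightT-ascent (rightT-Permutation a b h) asc)))

-- Bruhat order under left multiplication

≤B-trans : ∀ {n} {u v w : Perm n} → u ≤B v → v ≤B w → u ≤B w
≤B-trans p ≤B-refl = p
≤B-trans p (≤B-step a b a≢b q lt) = ≤B-step a b a≢b (≤B-trans p q) lt

≤B-len : ∀ {n} {v w : Perm n} → v ≤B w → len v ℕ.≤ len w
≤B-len ≤B-refl = ℕP.≤-refl
≤B-len (≤B-step a b _ p lt) = ℕP.≤-trans (≤B-len p) (ℕP.<⇒≤ lt)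

sL-rightT : ∀ {m} (i : Fin m) {π} → Permutation π → ∃ λ a → ∃ λ b → a ≢ b × sL i π ≡ rightT a b π
sL-rightT i {π} h with Permutation-surjective h (inject₁ i) | Permutation-surjective h (Fin.suc i)
... | p , πp | q , πq = p , q , (λ { refl → inject₁≢suc i (trans (sym πp) πq) }) ,
  sym (trans (rightT-swapValues p q h) (cong₂ (λ x y → swapValues x y π) πp πq))

≤B-sL-up : ∀ {m} (i : Fin m) {π} → Permutation π → len (sL i π) ≡ suc (len π) → π ≤B sL i π
≤B-sL-up i {π} h up with sL-rightT i h
... | a , b , a≢b , e = subst (π ≤B_) (sym e)
        (≤B-step a b a≢b ≤B-refl (ℕP.≤-reflexive (trans (sym up) (cong len e))))

sL-≢ : ∀ {m} (i : Fin m) {π} → len π ≡ suc (len (sL i π)) → sL i π ≢ π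
sL-≢ i down e = ℕP.1+n≢n (trans (sym down) (cong len (sym e)))

≤B-Permutation : ∀ {n} {v w : Perm n} → v ≤B w → Permutation v → Permutation w
≤B-Permutation ≤B-refl h = h
≤B-Permutation (≤B-step a b _ p _) h = rightT-Permutation a b (≤B-Permutation p h)

-- The ascent can be destroyed only if its values are i and i + 1, and then the left and the right
-- multiplication coincide.
ascent-sL : ∀ {m} (i : Fin m) {π} {a b} → Permutation π → Ascent a b π → Ascent a b (sL i π) ⊎ sL i π ≡ rightT a b π
ascent-sL i {π} {a} {b} h (inj₁ (a<b , lt)) with lookup π a Fin.≟ inject₁ i | lookup π b Fin.≟ Fin.suc i
... | yes p | yes q = inj₂ (sym (trans (rightT-swapValues a b h) (cong₂ (λ x y → swapValues x y π) p q)))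
... | no p | _ = inj₁ (inj₁ (a<b , subst₂ Fin._<_ (sym (lookup-sL i π a)) (sym (lookup-sL i π b))
                   (adjacent-swap-mono i lt (p ∘ proj₁))))
... | _ | no q = inj₁ (inj₁ (a<b , subst₂ Fin._<_ (sym (lookup-sL i π a)) (sym (lookup-sL i π b))
                   (adjacent-swap-mono i lt (q ∘ proj₂))))
ascent-sL i {π} {a} {b} h (inj₂ (b<a , lt)) with lookup π b Fin.≟ inject₁ i | lookup π a Fin.≟ Fin.suc i
... | yes p | yes q = inj₂ (sym (trans (rightT-swapValues a b h) (trans (swapValues-comm _ _ π)
                        (cong₂ (λ x y → swapValues x y π) p q))))
... | no p | _ = inj₁ (inj₂ (b<a , subst₂ Fin._<_ (sym (lookup-sL i π b)) (sym (lookup-sL i π a))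
                   (adjacent-swap-mono i lt (p ∘ proj₁))))
... | _ | no q = inj₁ (inj₂ (b<a , subst₂ Fin._<_ (sym (lookup-sL i π b)) (sym (lookup-sL i π a))
                   (adjacent-swap-mono i lt (q ∘ proj₂))))

ascent-sL-≤B : ∀ {m} (i : Fin m) {π} {a b} → Permutation π → a ≢ b → len π ℕ.< len (rightT a b π) →
  sL i π ≤B sL i (rightT a b π) ⊎ sL i π ≡ rightT a b π
ascent-sL-≤B i {π} {a} {b} h a≢b lt with ascent-sL i h (len-increase⇒ascent h a≢b lt)
... | inj₂ e = inj₂ e
... | inj₁ asc = inj₁ (subst (sL i π ≤B_) (sym (rightT-swapValues-commute a b _ _ π))
        (≤B-step a b a≢b ≤B-refl (len-rightT-ascent (sL-Permutation i h) asc)))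

-- Bruhat steps are compatible with left multiplication by s_i except for the step from u to s_i u
-- itself, so common lower bounds of {v , s_i v} remain lower bounds of {w , s_i w}; dually for upper bounds.
≤B-lower : ∀ {m} (i : Fin m) {v w} → Permutation v → v ≤B w → ∀ {y} → y ≤B v → y ≤B sL i v → y ≤B sL i w
≤B-lower i h ≤B-refl y≤v y≤sv = y≤sv
≤B-lower i h (≤B-step {u} a b a≢b p lt) {y} y≤v y≤sv with ascent-sL-≤B i (≤B-Permutation p h) a≢b lt
... | inj₁ q = ≤B-trans (≤B-lower i h p y≤v y≤sv) q
-- In the exceptional case `sL i` undoes the step and returns to `u`, which lies above `v` and so
-- above `y`.
... | inj₂ e = subst (y ≤B_) (trans (sym (sL-involutive i u)) (cong (sL i) e)) (≤B-trans y≤v p)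

≤B-upper : ∀ {m} (i : Fin m) {v w} → Permutation v → v ≤B w → ∀ {y} → w ≤B y → sL i w ≤B y → sL i v ≤B y
≤B-upper i h ≤B-refl w≤y sw≤y = sw≤y
≤B-upper i h (≤B-step {u} a b a≢b p lt) {y} w≤y sw≤y with ascent-sL-≤B i (≤B-Permutation p h) a≢b lt
... | inj₁ q = ≤B-upper i h p (≤B-trans (≤B-step a b a≢b ≤B-refl lt) w≤y) (≤B-trans q sw≤y)
... | inj₂ e = ≤B-upper i h p (≤B-trans (≤B-step a b a≢b ≤B-refl lt) w≤y) (subst (_≤B y) (sym e) w≤y)

-- Positive braid words and normal forms

infix 4 _∼_
-- Equality in the positive braid monoid. The relation s_i² = 1 is absent, so equivalent words have
-- equal lengths and give equal braids, not merely equal permutations.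
data _∼_ {m : ℕ} : List (Fin m) → List (Fin m) → Set where
  ∼-refl : ∀ {x} → x ∼ x
  ∼-sym : ∀ {x y} → x ∼ y → y ∼ x
  ∼-trans : ∀ {x y z} → x ∼ y → y ∼ z → x ∼ z
  ∼-cons : ∀ i {x y} → x ∼ y → i ∷ x ∼ i ∷ y
  ∼-far : ∀ i j x → suc (toℕ i) ℕ.< toℕ j → i ∷ j ∷ x ∼ j ∷ i ∷ x
  ∼-braid : ∀ i j x → toℕ j ≡ suc (toℕ i) → i ∷ j ∷ i ∷ x ∼ j ∷ i ∷ j ∷ x

∼-reflexive : ∀ {m} {x y : List (Fin m)} → x ≡ y → x ∼ y
∼-reflexive refl = ∼-refl

∼-prepend : ∀ {m} (z : List (Fin m)) {x y} → x ∼ y → z ++ x ∼ z ++ y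
∼-prepend [] e = e
∼-prepend (i ∷ z) e = ∼-cons i (∼-prepend z e)

∼-append : ∀ {m} (z : List (Fin m)) {x y} → x ∼ y → x ++ z ∼ y ++ z
∼-append z ∼-refl = ∼-refl
∼-append z (∼-sym e) = ∼-sym (∼-append z e)
∼-append z (∼-trans e f) = ∼-trans (∼-append z e) (∼-append z f)
∼-append z (∼-cons i e) = ∼-cons i (∼-append z e)
∼-append z (∼-far i j x p) = ∼-far i j (x ++ z) p
∼-append z (∼-braid i j x p) = ∼-braid i j (x ++ z) p

∼-map : ∀ {m n} (f : Fin m → Fin n) → (∀ i → toℕ (f i) ≡ toℕ i) → ∀ {x y} → x ∼ y → map f x ∼ map f y
∼-map f h ∼-refl = ∼-refl
∼-map f h (∼-sym e) = ∼-sym (∼-map f h e)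
∼-map f h (∼-trans e e′) = ∼-trans (∼-map f h e) (∼-map f h e′)
∼-map f h (∼-cons i e) = ∼-cons (f i) (∼-map f h e)
∼-map f h (∼-far i j x p) =
  ∼-far (f i) (f j) (map f x) (subst₂ (λ a b → suc a ℕ.< b) (sym (h i)) (sym (h j)) p)
∼-map f h (∼-braid i j x p) =
  ∼-braid (f i) (f j) (map f x) (trans (h j) (trans p (cong suc (sym (h i)))))

∼-inject₁ : ∀ {m} {x y : List (Fin m)} → x ∼ y → map inject₁ x ∼ map inject₁ y
∼-inject₁ = ∼-map inject₁ FinP.toℕ-inject₁

∼-length : ∀ {m} {x y : List (Fin m)} → x ∼ y → length x ≡ length y
∼-length ∼-refl = refl
∼-length (∼-sym e) = sym (∼-length e)
∼-length (∼-trans e f) = trans (∼-length e) (∼-length f)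
∼-length (∼-cons i e) = cong suc (∼-length e)
∼-length (∼-far i j x p) = refl
∼-length (∼-braid i j x p) = refl

-- Simple transpositions satisfy the braid relations

swap-conjugate : ∀ {n} (a b c d k : Fin n) →
  swapF a b (swapF c d k) ≡ swapF (swapF a b c) (swapF a b d) (swapF a b k)
swap-conjugate a b c d k = swap-natural (swapF a b) (λ _ _ → swap-injective a b) c d k

-- Conjugating the swap of j and j + 1 by s_i swaps their images under s_i, which are again j and j
-- + 1.
sL-far : ∀ {m} (i j : Fin m) → suc (toℕ i) ℕ.< toℕ j → ∀ π → sL i (sL j π) ≡ sL j (sL i π)
sL-far i j i+1<j π = lookup-ext λ k →
  trans (lookup-sL i (sL j π) k) (trans (cong s (lookup-sL j π k))
    (trans (swap-conjugate (inject₁ i) (Fin.suc i) (inject₁ j) (Fin.suc j) (lookup π k))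
      (trans (cong₂ (λ a b → swapF a b (s (lookup π k))) (swap-other (ne 0 1) (ne 0 0)) (swap-other (ne 1 1) (ne 1 0)))
        (sym (trans (lookup-sL j (sL i π) k) (cong (swapF (inject₁ j) (Fin.suc j)) (lookup-sL i π k)))))))
  where
  s = swapF (inject₁ i) (Fin.suc i)
  -- `pos 0` and `pos 1` are the two values exchanged by a generator. The second argument of `ne` is
  -- complemented: 1 selects the lower value of `i`, 0 the upper.
  pos : ∀ {m} → ℕ → Fin m → Fin (suc m)
  pos zero i = inject₁ i
  pos (suc _) i = Fin.suc i
  small : ∀ {m} b (i : Fin m) → toℕ (pos b i) ℕ.≤ suc (toℕ i)
  small zero i = ℕP.≤-trans (ℕP.≤-reflexive (FinP.toℕ-inject₁ i)) (ℕP.n≤1+n _)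
  small (suc _) i = ℕP.≤-refl
  large : ∀ {m} b (j : Fin m) → toℕ j ℕ.≤ toℕ (pos b j)
  large zero j = ℕP.≤-reflexive (sym (FinP.toℕ-inject₁ j))
  large (suc _) j = ℕP.n≤1+n _
  ne : ∀ b d → pos b j ≢ pos (1 ℕ.∸ d) i
  ne b d e = ℕP.<-irrefl (cong toℕ (sym e))
    (ℕP.≤-<-trans (small (1 ℕ.∸ d) i) (ℕP.<-≤-trans i+1<j (large b j)))

-- Both sides are conjugates equal to the transposition of the outer values `a` and `c`.
sL-braid : ∀ {m} (i j : Fin m) → toℕ j ≡ suc (toℕ i) → ∀ π → sL i (sL j (sL i π)) ≡ sL j (sL i (sL j π))
sL-braid i j j≡i+1 π = lookup-ext λ k →
  trans (lookup-sL i (sL j (sL i π)) k)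
    (trans (cong (swapF a b) (trans (lookup-sL j (sL i π) k) (cong (swapF (inject₁ j) c) (lookup-sL i π k))))
      (trans (left (lookup π k)) (sym
        (trans (lookup-sL j (sL i (sL j π)) k)
          (trans (cong (swapF (inject₁ j) c) (trans (lookup-sL i (sL j π) k) (cong (swapF a b) (lookup-sL j π k))))
            (right (lookup π k)))))))
  where
  a = inject₁ i
  b = Fin.suc i
  c = Fin.suc j
  b≡ : inject₁ j ≡ b
  b≡ = FinP.toℕ-injective (trans (FinP.toℕ-inject₁ j) j≡i+1)
  toℕ-c : toℕ c ≡ suc (suc (toℕ i))
  toℕ-c = cong suc j≡i+1
  c≢a : c ≢ a
  c≢a e = ℕP.m≢1+n+m (toℕ i) (trans (sym (FinP.toℕ-inject₁ i)) (trans (cong toℕ (sym e)) toℕ-c))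
  c≢b : c ≢ b
  c≢b e = ℕP.1+n≢n (ℕP.suc-injective (trans (sym toℕ-c) (cong toℕ e)))
  left : ∀ k → swapF a b (swapF (inject₁ j) c (swapF a b k)) ≡ swapF a c k
  left k = trans (swap-conjugate a b (inject₁ j) c (swapF a b k))
    (trans (cong (swapF (swapF a b (inject₁ j)) (swapF a b c)) (swap-involutive a b k))
      (cong₂ (λ y z → swapF y z k) (trans (cong (swapF a b) b≡) (swap-right a b)) (swap-other c≢a c≢b)))
  right : ∀ k → swapF (inject₁ j) c (swapF a b (swapF (inject₁ j) c k)) ≡ swapF a c k
  right k = trans (swap-conjugate (inject₁ j) c a b (swapF (inject₁ j) c k))
    (trans (cong (swapF (swapF (inject₁ j) c a) (swapF (inject₁ j) c b)) (swap-involutive (inject₁ j) c k))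
      (cong₂ (λ y z → swapF y z k)
        (swap-other (λ e → inject₁≢suc i (trans e b≡)) (c≢a ∘ sym))
        (trans (cong (swapF (inject₁ j) c) (sym b≡)) (swap-left (inject₁ j) c))))

∼-wordPerm : ∀ {m} {x y : List (Fin m)} → x ∼ y → wordPerm x ≡ wordPerm y
∼-wordPerm ∼-refl = refl
∼-wordPerm (∼-sym e) = sym (∼-wordPerm e)
∼-wordPerm (∼-trans e f) = trans (∼-wordPerm e) (∼-wordPerm f)
∼-wordPerm (∼-cons i e) = cong (sL i) (∼-wordPerm e)
∼-wordPerm (∼-far i j x p) = sL-far i j p (wordPerm x)
∼-wordPerm (∼-braid i j x p) = sL-braid i j p (wordPerm x)

-- Run m stands for the words s_k s_{k+1} ⋯ s_{m-1}, the minimal coset representatives of S_{m+1}/S_m.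
data Run : ℕ → Set where
  none : ∀ {m} → Run m
  ext : ∀ {m} → Run m → Run (suc m)

runWord : ∀ {m} → Run m → List (Fin m)
runWord none = []
runWord (ext {m} r) = map inject₁ (runWord r) ++ fromℕ m ∷ []

-- Deodhar's trichotomy for a minimal coset representative r: s_i r is a longer representative, a
-- shorter one, or r s_j with s_j in the parabolic subgroup.
data RunStep {m} (i : Fin (suc m)) (r : Run (suc m)) : Set where
  up : ∀ r′ → i ∷ runWord r ∼ runWord r′ → RunStep i r
  down : ∀ r′ → runWord r ∼ i ∷ runWord r′ → RunStep i r
  pass : ∀ j → i ∷ runWord r ∼ runWord r ++ inject₁ j ∷ [] → RunStep i r

inject₁<fromℕ : ∀ {m} (j : Fin m) → suc (toℕ (inject₁ (inject₁ j))) ℕ.< toℕ (fromℕ (suc m))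
inject₁<fromℕ {m} j = subst₂ (λ a b → suc a ℕ.< suc b)
  (sym (trans (FinP.toℕ-inject₁ (inject₁ j)) (FinP.toℕ-inject₁ j))) (sym (FinP.toℕ-fromℕ m))
  (s≤s (FinP.toℕ<n j))

fromℕ-commutes : ∀ {m} (u : List (Fin m)) z →
  fromℕ (suc m) ∷ map inject₁ (map inject₁ u) ++ z ∼ map inject₁ (map inject₁ u) ++ fromℕ (suc m) ∷ z
fromℕ-commutes [] z = ∼-refl
fromℕ-commutes (i ∷ u) z =
  ∼-trans (∼-sym (∼-far _ _ _ (inject₁<fromℕ i))) (∼-cons _ (fromℕ-commutes u z))

runStep : ∀ {m} (i : Fin (suc m)) (r : Run (suc m)) → RunStep i r
runStep i r with view i
runStep i none | ‵fromℕ = up (ext none) ∼-refl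
runStep i none | ‵inject₁ j = pass j ∼-refl
runStep i (ext none) | ‵fromℕ = down none ∼-refl
-- Here r = w b top with `top` commuting past `w`, so top w b top = w (top b top) = w b top b: the
-- letter `b` comes out on the right.
runStep {suc m} i (ext (ext r)) | ‵fromℕ = pass (fromℕ m)
  (∼-trans (∼-cons top (∼-reflexive regroup))
  (∼-trans (fromℕ-commutes (runWord r) (b ∷ top ∷ []))
  (∼-trans (∼-prepend w (∼-sym (∼-braid b top [] (cong suc (sym (FinP.toℕ-inject₁ (fromℕ m)))))))
  (∼-reflexive (sym (trans (cong (_++ b ∷ []) regroup) (ListP.++-assoc w (b ∷ top ∷ []) (b ∷ []))))))))
  where
  top = fromℕ (suc m)
  b = inject₁ (fromℕ m)
  w = map inject₁ (map inject₁ (runWord r))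
  regroup : map inject₁ (map inject₁ (runWord r) ++ fromℕ m ∷ []) ++ top ∷ [] ≡ w ++ b ∷ top ∷ []
  regroup = trans (cong (_++ top ∷ []) (ListP.map-++ inject₁ (map inject₁ (runWord r)) (fromℕ m ∷ [])))
              (ListP.++-assoc w (b ∷ []) (top ∷ []))
runStep {suc m} i (ext r) | ‵inject₁ j with runStep j r
... | up r′ e = up (ext r′) (∼-append (fromℕ (suc m) ∷ []) (∼-inject₁ e))
... | down r′ e = down (ext r′) (∼-append (fromℕ (suc m) ∷ []) (∼-inject₁ e))
-- The letter that leaves the shorter run has index at least two below `top`, so it also commutes
-- past the last letter of `ext r`.
... | pass k e = pass (inject₁ k)
  (∼-trans (∼-append (top ∷ []) (∼-inject₁ e))
  (∼-trans (∼-reflexive (trans (cong (_++ top ∷ []) (ListP.map-++ inject₁ (runWord r) (inject₁ k ∷ [])))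
                          (ListP.++-assoc w (b ∷ []) (top ∷ []))))
  (∼-trans (∼-prepend w (∼-far b top [] (inject₁<fromℕ k)))
  (∼-reflexive (sym (ListP.++-assoc w (top ∷ []) (b ∷ [])))))))
  where
  top = fromℕ (suc m)
  b = inject₁ (inject₁ k)
  w = map inject₁ (runWord r)

-- Normal forms of permutations in S_{m+1}, along the chain of cosets S_{m+1}/S_m, S_m/S_{m-1}, ….
data Code : ℕ → Set where
  trivial : Code 0
  _▸_ : ∀ {m} → Run (suc m) → Code m → Code (suc m)

nf : ∀ {m} → Code m → List (Fin m)
nf trivial = []
nf (r ▸ c) = runWord r ++ map inject₁ (nf c)

data Step {m} (i : Fin m) (c : Code m) : Set where
  up : ∀ c′ → i ∷ nf c ∼ nf c′ → Step i c
  down : ∀ c′ → nf c ∼ i ∷ nf c′ → Step i c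

-- A letter that passes through the run acts on the remaining code of the smaller group; at some
-- level it is absorbed, so no third case remains.
step : ∀ {m} (i : Fin m) (c : Code m) → Step i c
step i (r ▸ c) with runStep i r
... | up r′ e = up (r′ ▸ c) (∼-append _ e)
... | down r′ e = down (r′ ▸ c) (∼-append _ e)
... | pass j e with step j c
...   | up c′ e′ = up (r ▸ c′) (∼-trans (∼-append _ e) (∼-trans (∼-reflexive (ListP.++-assoc (runWord r) _ _))
                    (∼-prepend (runWord r) (∼-inject₁ e′))))
...   | down c′ e′ = down (r ▸ c′) (∼-trans (∼-prepend (runWord r) (∼-inject₁ e′))
                      (∼-trans (∼-reflexive (sym (ListP.++-assoc (runWord r) _ _))) (∼-sym (∼-append _ e))))

-- Normal forms are reduced words

data Climb {m} : ℕ → ℕ → List (Fin m) → Set where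
  [] : ∀ {b} → Climb b b []
  _∷_ : ∀ {a b i ws} → toℕ i ≡ a → Climb (suc a) b ws → Climb a b (i ∷ ws)

climb-≤ : ∀ {m a b} {ws : List (Fin m)} → Climb a b ws → a ℕ.≤ b
climb-≤ [] = ℕP.≤-refl
climb-≤ (_ ∷ c) = ℕP.<⇒≤ (climb-≤ c)

climb-map : ∀ {m n a b} {ws : List (Fin m)} (f : Fin m → Fin n) → (∀ i → toℕ (f i) ≡ toℕ i) →
  Climb a b ws → Climb a b (map f ws)
climb-map f h [] = []
climb-map f h (_∷_ {i = i} e c) = trans (h i) e ∷ climb-map f h c

climb-snoc : ∀ {m a b} {ws : List (Fin m)} → Climb a b ws → ∀ {i} → toℕ i ≡ b → Climb a (suc b) (ws ++ i ∷ [])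
climb-snoc [] e = e ∷ []
climb-snoc (e′ ∷ c) e = e′ ∷ climb-snoc c e

runWord-climb : ∀ {m} (r : Run m) → ∃ λ a → Climb a m (runWord r)
runWord-climb {m} none = m , []
runWord-climb (ext {m} r) with runWord-climb r
... | a , c = a , climb-snoc (climb-map inject₁ FinP.toℕ-inject₁ c) (FinP.toℕ-fromℕ m)

FixesAbove : ∀ {n} → ℕ → Perm n → Set
FixesAbove b π = ∀ j → b ℕ.< toℕ j → lookup π j ≡ j

sL-FixesAbove : ∀ {m b} (i : Fin m) {π} → toℕ i ℕ.< b → FixesAbove b π → FixesAbove b (sL i π)
sL-FixesAbove {b = b} i {π} i<b h j b<j = trans (lookup-sL i π j) (trans (cong (swapF (inject₁ i) (Fin.suc i)) (h j b<j))
  (swap-other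
    (λ { refl → ℕP.<-asym i<b (subst (b ℕ.<_) (FinP.toℕ-inject₁ i) b<j) })
    (λ { refl → ℕP.<-irrefl refl (ℕP.<-≤-trans b<j i<b) })))

record Climbed {m} (π : Perm (suc m)) (p : Fin (suc m)) (a k : ℕ) (σ : Perm (suc m)) : Set where
  field
    perm : Permutation σ
    value : toℕ (lookup σ p) ≡ a
    fixes : FixesAbove (toℕ p) σ
    longer : len σ ≡ k ℕ.+ len π

open Climbed

-- Reading the run from its right end, each letter s_i lowers the value at position `p` from i + 1
-- to i. Positions beyond `p` stay fixed, so the value i sits left of `p` and each letter adds one
-- to the length.
climb-len : ∀ {m a} {ws : List (Fin m)} {π p} → Permutation π → lookup π p ≡ p → FixesAbove (toℕ p) π →
  Climb a (toℕ p) ws → Climbed π p a (length ws) (List.foldr sL π ws)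
climb-len h πp fix [] = record { perm = h ; value = cong toℕ πp ; fixes = fix ; longer = refl }
climb-len {π = π} {p} h πp fix (_∷_ {a} {i = i} {ws} refl c) = record
  { perm = sL-Permutation i (perm ih)
  ; value = trans (cong toℕ (trans (lookup-sL i σ p) (trans (cong (swapF (inject₁ i) (Fin.suc i)) σp)
              (swap-right (inject₁ i) (Fin.suc i))))) (FinP.toℕ-inject₁ i)
  ; fixes = sL-FixesAbove i {σ} (climb-≤ c) (fixes ih)
  ; longer = trans rises (cong suc (longer ih)) }
  where
  σ = List.foldr sL π ws
  ih = climb-len h πp fix c
  σp : lookup σ p ≡ Fin.suc i
  σp = FinP.toℕ-injective (value ih)
  rises : len (sL i σ) ≡ suc (len σ)
  rises with Permutation-surjective (perm ih) (inject₁ i)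
  ... | q , σq with FinP.<-cmp q p
  ...   | tri< q<p _ _ = len-sL-up i (perm ih) σq σp q<p
  ...   | tri≈ _ refl _ = contradiction (trans (sym σq) σp) (inject₁≢suc i)
  -- A value beyond `p` is a fixed point, hence larger than `p`, whereas i is smaller than `p`.
  ...   | tri> _ _ p<q = contradiction
            (subst (toℕ p ℕ.<_) (trans (cong toℕ (trans (sym (fixes ih q p<q)) σq)) (FinP.toℕ-inject₁ i)) p<q)
            (ℕP.<-asym (climb-≤ c))

len-idPerm : ∀ n → len (idPerm n) ≡ 0
len-idPerm n = trans (sum-map-cong _ zero-term) (sum-zeros (List.cartesianProduct (List.allFin n) (List.allFin n)))
  where
  sum-zeros : (L : List (Fin n × Fin n)) → sumℕ (map (λ _ → 0) L) ≡ 0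
  sum-zeros [] = refl
  sum-zeros (_ ∷ L) = sum-zeros L
  zero-term : ∀ y → y ∈ List.cartesianProduct (List.allFin n) (List.allFin n) →
    (if does (toℕ (proj₁ y) ℕ.<? toℕ (proj₂ y)) ∧ does (toℕ (lookup (idPerm n) (proj₂ y)) ℕ.<? toℕ (lookup (idPerm n) (proj₁ y))) then 1 else 0) ≡ 0
  zero-term (a , b) _ rewrite VecP.lookup-allFin a | VecP.lookup-allFin b with FinP.<-cmp a b
  ... | tri< a<b _ b≮a rewrite dec-true (toℕ a ℕ.<? toℕ b) a<b | dec-false (toℕ b ℕ.<? toℕ a) b≮a = refl
  ... | tri≈ a≮b _ _ rewrite dec-false (toℕ a ℕ.<? toℕ b) a≮b = refl
  ... | tri> a≮b _ _ rewrite dec-false (toℕ a ℕ.<? toℕ b) a≮b = refl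

wordPerm-FixesAbove : ∀ {m n} (f : Fin m → Fin n) → (∀ i → toℕ (f i) ≡ toℕ i) → (ws : List (Fin m)) →
  FixesAbove m (wordPerm (map f ws))
wordPerm-FixesAbove f h [] j _ = VecP.lookup-allFin j
wordPerm-FixesAbove {m} f h (i ∷ ws) =
  sL-FixesAbove (f i) {wordPerm (map f ws)} (subst (ℕ._< m) (sym (h i)) (FinP.toℕ<n i)) (wordPerm-FixesAbove f h ws)

-- The embedding `f` keeps the ambient symmetric group fixed while the recursion descends to smaller
-- codes. Each run climbs to position m + 1, which the rest of the word has not moved.
len-map-nf : ∀ {m n} (f : Fin m → Fin n) → (∀ i → toℕ (f i) ≡ toℕ i) → (c : Code m) →
  len (wordPerm (map f (nf c))) ≡ length (nf c)
len-map-nf {n = n} f h trivial = len-idPerm (suc n)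
len-map-nf {suc m} f h (r ▸ c) = begin
  len (wordPerm (map f (w ++ u)))               ≡⟨ cong (len ∘ wordPerm) (ListP.map-++ f w u) ⟩
  len (wordPerm (map f w ++ map f u))           ≡⟨ cong len (ListP.foldr-++ sL (idPerm _) (map f w) (map f u)) ⟩
  len (List.foldr sL (wordPerm (map f u)) (map f w))
    ≡⟨ longer (climb-len {p = p} (wordPerm-Permutation (map f u))
        (fix p (subst (m ℕ.<_) (sym toℕ-p) (ℕP.n<1+n m)))
        (λ j p<j → fix j (ℕP.<-trans (ℕP.n<1+n m) (subst (ℕ._< toℕ j) toℕ-p p<j)))
        (subst (λ b → Climb (proj₁ (runWord-climb r)) b (map f w)) (sym toℕ-p) (climb-map f h (proj₂ (runWord-climb r))))) ⟩
  length (map f w) ℕ.+ len (wordPerm (map f u)) ≡⟨ cong₂ ℕ._+_ (ListP.length-map f w) (cong (len ∘ wordPerm) fuse) ⟩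
  length w ℕ.+ len (wordPerm (map (f ∘ inject₁) (nf c))) ≡⟨ cong (length w ℕ.+_) (len-map-nf (f ∘ inject₁) h′ c) ⟩
  length w ℕ.+ length (nf c)                     ≡⟨ cong (length w ℕ.+_) (sym (ListP.length-map inject₁ (nf c))) ⟩
  length w ℕ.+ length u                          ≡⟨ sym (ListP.length-++ w) ⟩
  length (w ++ u)                                ∎
  where
  open ≡-Reasoning
  w = runWord r
  u = map inject₁ (nf c)
  p = Fin.suc (f (fromℕ m))
  toℕ-p : toℕ p ≡ suc m
  toℕ-p = cong suc (trans (h (fromℕ m)) (FinP.toℕ-fromℕ m))
  h′ : ∀ i → toℕ (f (inject₁ i)) ≡ toℕ i
  h′ i = trans (h (inject₁ i)) (FinP.toℕ-inject₁ i)
  fuse : map f u ≡ map (f ∘ inject₁) (nf c)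
  fuse = sym (ListP.map-∘ (nf c))
  fix : FixesAbove m (wordPerm (map f u))
  fix = subst (λ z → FixesAbove m (wordPerm z)) (sym fuse) (wordPerm-FixesAbove (f ∘ inject₁) h′ (nf c))

len-nf : ∀ {m} (c : Code m) → len (wordPerm (nf c)) ≡ length (nf c)
len-nf c = trans (cong (len ∘ wordPerm) (sym (ListP.map-id (nf c)))) (len-map-nf id (λ _ → refl) c)

identity : ∀ m → Code m
identity zero = trivial
identity (suc m) = none ▸ identity m

nf-identity : ∀ m → nf (identity m) ≡ []
nf-identity zero = refl
nf-identity (suc m) = cong (map inject₁) (nf-identity m)

-- Reduced words are equivalent to normal forms

len-wordPerm-≤ : ∀ {m} (ws : List (Fin m)) → len (wordPerm ws) ℕ.≤ length ws
len-wordPerm-≤ {m} [] = ℕP.≤-reflexive (len-idPerm (suc m))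
len-wordPerm-≤ (i ∷ ws) = ℕP.≤-trans (len-sL-≤ i (wordPerm-Permutation ws)) (s≤s (len-wordPerm-≤ ws))

reduced-tail : ∀ {m} (i : Fin m) ws → length (i ∷ ws) ≡ len (wordPerm (i ∷ ws)) → length ws ≡ len (wordPerm ws)
reduced-tail i ws red = ℕP.≤-antisym
  (ℕP.≤-pred (ℕP.≤-trans (ℕP.≤-reflexive red) (len-sL-≤ i (wordPerm-Permutation ws))))
  (len-wordPerm-≤ ws)

-- A form of Matsumoto's theorem: letters are prepended one by one, and a `down` step would
-- represent the permutation of `i ∷ ws` by a word shorter than `ws`, against reducedness.
reduced-nf : ∀ {m} (ws : List (Fin m)) → length ws ≡ len (wordPerm ws) → ∃ λ c → ws ∼ nf c
reduced-nf {m} [] _ = identity m , ∼-reflexive (sym (nf-identity m))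
reduced-nf (i ∷ ws) red with reduced-nf ws (reduced-tail i ws red)
... | c , e with step i c
...   | up c′ e′ = c′ , ∼-trans (∼-cons i e) e′
...   | down c′ e′ = contradiction shorter (ℕP.<-asym (ℕP.n<1+n _))
  where
  sL-nf : wordPerm (i ∷ ws) ≡ wordPerm (nf c′)
  sL-nf = trans (cong (sL i) (∼-wordPerm (∼-trans e e′))) (sL-involutive i _)
  shorter : suc (length ws) ℕ.< length ws
  shorter = ℕP.≤-trans (s≤s (ℕP.≤-reflexive red))
    (ℕP.≤-trans (s≤s (ℕP.≤-trans (ℕP.≤-reflexive (cong len sL-nf)) (len-wordPerm-≤ (nf c′))))
      (ℕP.≤-reflexive (sym (∼-length (∼-trans e e′)))))

-- The Morton–Franks–Williams bound

infix 4 _≃_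
data _≃_ {m : ℕ} : List (Gen m) → List (Gen m) → Set where
  ≃-refl : ∀ {x} → x ≃ x
  ≃-sym : ∀ {x y} → x ≃ y → y ≃ x
  ≃-trans : ∀ {x y z} → x ≃ y → y ≃ z → x ≃ z
  ≃-cons : ∀ g {x y} → x ≃ y → g ∷ x ≃ g ∷ y
  ≃-cancel⁺⁻ : ∀ i x → σ⁺ i ∷ σ⁻ i ∷ x ≃ x
  ≃-cancel⁻⁺ : ∀ i x → σ⁻ i ∷ σ⁺ i ∷ x ≃ x
  ≃-far : ∀ i j x → suc (toℕ i) ℕ.< toℕ j → σ⁺ i ∷ σ⁺ j ∷ x ≃ σ⁺ j ∷ σ⁺ i ∷ x
  ≃-braid : ∀ i j x → toℕ j ≡ suc (toℕ i) → σ⁺ i ∷ σ⁺ j ∷ σ⁺ i ∷ x ≃ σ⁺ j ∷ σ⁺ i ∷ σ⁺ j ∷ x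

≃-reflexive : ∀ {m} {x y : List (Gen m)} → x ≡ y → x ≃ y
≃-reflexive refl = ≃-refl

≃-prepend : ∀ {m} (z : List (Gen m)) {x y} → x ≃ y → z ++ x ≃ z ++ y
≃-prepend [] e = e
≃-prepend (g ∷ z) e = ≃-cons g (≃-prepend z e)

≃-append : ∀ {m} (z : List (Gen m)) {x y} → x ≃ y → x ++ z ≃ y ++ z
≃-append z ≃-refl = ≃-refl
≃-append z (≃-sym e) = ≃-sym (≃-append z e)
≃-append z (≃-trans e f) = ≃-trans (≃-append z e) (≃-append z f)
≃-append z (≃-cons g e) = ≃-cons g (≃-append z e)
≃-append z (≃-cancel⁺⁻ i x) = ≃-cancel⁺⁻ i (x ++ z)
≃-append z (≃-cancel⁻⁺ i x) = ≃-cancel⁻⁺ i (x ++ z)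
≃-append z (≃-far i j x p) = ≃-far i j (x ++ z) p
≃-append z (≃-braid i j x p) = ≃-braid i j (x ++ z) p

posBraid-resp-∼ : ∀ {m} {x y : List (Fin m)} → x ∼ y → posBraid x ≃ posBraid y
posBraid-resp-∼ ∼-refl = ≃-refl
posBraid-resp-∼ (∼-sym e) = ≃-sym (posBraid-resp-∼ e)
posBraid-resp-∼ (∼-trans e f) = ≃-trans (posBraid-resp-∼ e) (posBraid-resp-∼ f)
posBraid-resp-∼ (∼-cons i e) = ≃-cons (σ⁺ i) (posBraid-resp-∼ e)
posBraid-resp-∼ (∼-far i j x p) = ≃-far i j (posBraid x) p
posBraid-resp-∼ (∼-braid i j x p) = ≃-braid i j (posBraid x) p

invPosBraid-∷ : ∀ {m} (i : Fin m) ws → invPosBraid (i ∷ ws) ≡ invPosBraid ws ++ σ⁻ i ∷ []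
invPosBraid-∷ i ws = ListP.unfold-reverse (σ⁻ i) (map σ⁻ ws)

invPosBraid-++ : ∀ {m} (x y : List (Fin m)) → invPosBraid (x ++ y) ≡ invPosBraid y ++ invPosBraid x
invPosBraid-++ x y = trans (cong reverse (ListP.map-++ σ⁻ x y)) (ListP.reverse-++ (map σ⁻ x) (map σ⁻ y))

posBraid-inverseʳ : ∀ {m} (ws : List (Fin m)) → posBraid ws ++ invPosBraid ws ≃ []
posBraid-inverseʳ [] = ≃-refl
posBraid-inverseʳ (i ∷ ws) = ≃-trans
  (≃-cons (σ⁺ i) (≃-trans
    (≃-reflexive (trans (cong (posBraid ws ++_) (invPosBraid-∷ i ws)) (sym (ListP.++-assoc (posBraid ws) _ _))))
    (≃-append (σ⁻ i ∷ []) (posBraid-inverseʳ ws))))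
  (≃-cancel⁺⁻ i [])

posBraid-inverseˡ : ∀ {m} (ws : List (Fin m)) → invPosBraid ws ++ posBraid ws ≃ []
posBraid-inverseˡ [] = ≃-refl
posBraid-inverseˡ (i ∷ ws) = ≃-trans
  (≃-reflexive (trans (cong (_++ posBraid (i ∷ ws)) (invPosBraid-∷ i ws)) (ListP.++-assoc (invPosBraid ws) _ _)))
  (≃-trans (≃-prepend (invPosBraid ws) (≃-cancel⁻⁺ i (posBraid ws))) (posBraid-inverseˡ ws))

-- The far and braid relations of `_≃_` are given for positive letters only; for inverses they
-- follow from uniqueness of inverses, x⁻¹ = x⁻¹ x y⁻¹ = y⁻¹.
invPosBraid-resp-∼ : ∀ {m} {x y : List (Fin m)} → x ∼ y → invPosBraid x ≃ invPosBraid y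
invPosBraid-resp-∼ {x = x} {y} e =
  ≃-trans (≃-reflexive (sym (ListP.++-identityʳ (invPosBraid x))))
  (≃-trans (≃-prepend (invPosBraid x) (≃-sym (≃-trans (≃-append (invPosBraid y) (posBraid-resp-∼ e)) (posBraid-inverseʳ y))))
  (≃-trans (≃-reflexive (sym (ListP.++-assoc (invPosBraid x) _ _)))
  (≃-append (invPosBraid y) (posBraid-inverseˡ x))))

invPosBraid-snoc : ∀ {m} {i : Fin m} {x y} → x ∼ i ∷ y → ∀ z → invPosBraid x ++ z ≃ invPosBraid y ++ σ⁻ i ∷ z
invPosBraid-snoc {i = i} {x} {y} e z = ≃-trans (≃-append z (invPosBraid-resp-∼ e))
  (≃-reflexive (trans (cong (_++ z) (invPosBraid-∷ i y)) (ListP.++-assoc (invPosBraid y) _ _)))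

invPosBraid-inject₁ : ∀ {m} (ws : List (Fin m)) → invPosBraid (map inject₁ ws) ≡ map liftG (invPosBraid ws)
invPosBraid-inject₁ ws = trans (cong reverse (trans (sym (ListP.map-∘ ws)) (ListP.map-∘ ws)))
  (sym (ListP.reverse-map liftG (map σ⁻ ws)))

-- The writhe

sign : ∀ {m} → Gen m → ℤ
sign (σ⁺ _) = 1ℤ
sign (σ⁻ _) = - 1ℤ

writhe : ∀ {m} → List (Gen m) → ℤ
writhe [] = 0ℤ
writhe (g ∷ x) = sign g + writhe x

writhe-++ : ∀ {m} (x y : List (Gen m)) → writhe (x ++ y) ≡ writhe x + writhe y
writhe-++ [] y = sym (ℤP.+-identityˡ _)
writhe-++ (g ∷ x) y = trans (cong (λ u → sign g + u) (writhe-++ x y)) (sym (ℤP.+-assoc (sign g) _ _))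

writhe-≃ : ∀ {m} {x y : List (Gen m)} → x ≃ y → writhe x ≡ writhe y
writhe-≃ ≃-refl = refl
writhe-≃ (≃-sym e) = sym (writhe-≃ e)
writhe-≃ (≃-trans e f) = trans (writhe-≃ e) (writhe-≃ f)
writhe-≃ (≃-cons g e) = cong (λ u → sign g + u) (writhe-≃ e)
writhe-≃ (≃-cancel⁺⁻ i x) = cancel (writhe x)
  where
  cancel : ∀ u → 1ℤ + (- 1ℤ + u) ≡ u
  cancel = solve-∀
writhe-≃ (≃-cancel⁻⁺ i x) = cancel (writhe x)
  where
  cancel : ∀ u → - 1ℤ + (1ℤ + u) ≡ u
  cancel = solve-∀
writhe-≃ (≃-far i j x p) = refl
writhe-≃ (≃-braid i j x p) = refl

writhe-liftG : ∀ {m} (x : List (Gen m)) → writhe (map liftG x) ≡ writhe x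
writhe-liftG [] = refl
writhe-liftG (σ⁺ _ ∷ x) = cong (λ u → 1ℤ + u) (writhe-liftG x)
writhe-liftG (σ⁻ _ ∷ x) = cong (λ u → - 1ℤ + u) (writhe-liftG x)

writhe-posBraid : ∀ {m} (ws : List (Fin m)) → writhe (posBraid ws) ≡ + length ws
writhe-posBraid [] = refl
writhe-posBraid (i ∷ ws) = cong (λ u → 1ℤ + u) (writhe-posBraid ws)

writhe-invPosBraid : ∀ {m} (ws : List (Fin m)) → writhe (invPosBraid ws) ≡ - + length ws
writhe-invPosBraid [] = refl
writhe-invPosBraid (i ∷ ws) = begin
  writhe (invPosBraid (i ∷ ws))              ≡⟨ cong writhe (invPosBraid-∷ i ws) ⟩
  writhe (invPosBraid ws ++ σ⁻ i ∷ [])       ≡⟨ writhe-++ (invPosBraid ws) _ ⟩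
  writhe (invPosBraid ws) + (- 1ℤ + 0ℤ)      ≡⟨ cong (λ u → u + (- 1ℤ + 0ℤ)) (writhe-invPosBraid ws) ⟩
  - (+ length ws) + (- 1ℤ + 0ℤ)              ≡⟨ arith (+ length ws) ⟩
  - (1ℤ + + length ws)                       ∎
  where
  open ≡-Reasoning
  arith : ∀ u → - u + (- 1ℤ + 0ℤ) ≡ - (1ℤ + u)
  arith = solve-∀

writhe-βvw : ∀ {m} (rv rw : List (Fin m)) → writhe (βvw rv rw) ≡ + length rw ℤ.- + length rv
writhe-βvw rv rw = trans (writhe-++ (posBraid rw) _) (cong₂ _+_ (writhe-posBraid rw) (writhe-invPosBraid rv))

-- Coefficients of Laurent polynomials in a and z

+-shift-⇔ : ∀ e i a → (e + a ≡ i) ⇔ (e ≡ i ℤ.- a)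
+-shift-⇔ e i a = mk⇔ (λ { refl → fwd e a }) (λ { refl → bwd i a })
  where
  fwd : ∀ e a → e ≡ e + a ℤ.- a
  fwd = solve-∀
  bwd : ∀ i a → i ℤ.- a + a ≡ i
  bwd = solve-∀

coeff2-++ : ∀ p r i j → coeff2 (p ++ r) i j ≡ coeff2 p i j + coeff2 r i j
coeff2-++ [] r i j = sym (ℤP.+-identityˡ _)
coeff2-++ ((e , f , c) ∷ p) r i j = trans
  (cong (λ u → (if does (e ℤ.≟ i) ∧ does (f ℤ.≟ j) then c else 0ℤ) + u) (coeff2-++ p r i j)) (sym (ℤP.+-assoc (if does (e ℤ.≟ i) ∧ does (f ℤ.≟ j) then c else 0ℤ) _ _))

coeff2-neg2 : ∀ p i j → coeff2 (neg2 p) i j ≡ - coeff2 p i j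
coeff2-neg2 [] i j = refl
coeff2-neg2 ((e , f , c) ∷ p) i j with does (e ℤ.≟ i) ∧ does (f ℤ.≟ j)
... | true = trans (cong (λ u → - c + u) (coeff2-neg2 p i j)) (sym (ℤP.neg-distrib-+ c _))
... | false = trans (cong (λ u → 0ℤ + u) (coeff2-neg2 p i j)) (sym (ℤP.neg-distrib-+ 0ℤ (coeff2 p i j)))

coeff2-monMul2 : ∀ a b p i j → coeff2 (monMul2 a b p) i j ≡ coeff2 p (i ℤ.- a) (j ℤ.- b)
coeff2-monMul2 a b [] i j = refl
coeff2-monMul2 a b ((e , f , c) ∷ p) i j = cong₂ _+_
  (cong₂ (λ s t → if s ∧ t then c else 0ℤ)
    (does-⇔ (+-shift-⇔ e i a) (e + a ℤ.≟ i) (e ℤ.≟ i ℤ.- a))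
    (does-⇔ (+-shift-⇔ f j b) (f + b ℤ.≟ j) (f ℤ.≟ j ℤ.- b)))
  (coeff2-monMul2 a b p i j)

-- The Laurent polynomial Σ_{k ∈ W} z^{k-m}.
zTerms : ℕ → List ℕ → LP1
zTerms m = map (λ k → (+ k ℤ.- + m , 1ℤ))

zCoeff : ℕ → List ℕ → ℤ → ℤ
zCoeff m W = coeff1 (zTerms m W)

-- Multiplication by z^a in two guises: shifting the exponents (`f = suc`) or changing the
-- normalisation m (`f = id`).
zCoeff-shift : ∀ {m n a} (f : ℕ → ℕ) → (∀ k → + k ℤ.- + m + a ≡ + f k ℤ.- + n) → ∀ W j →
  zCoeff n (map f W) j ≡ zCoeff m W (j ℤ.- a)
zCoeff-shift f h [] j = refl
zCoeff-shift {m} {n} {a} f h (k ∷ W) j = cong₂ _+_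
  (cong (if_then 1ℤ else 0ℤ) (trans (cong (λ e → does (e ℤ.≟ j)) (sym (h k)))
    (does-⇔ (+-shift-⇔ (+ k ℤ.- + m) j a) (+ k ℤ.- + m + a ℤ.≟ j) (+ k ℤ.- + m ℤ.≟ j ℤ.- a))))
  (zCoeff-shift {m} {n} f h W j)

module HOMFLY (F : (k : ℕ) → List (Gen k) → LP2) (isHOMFLY : IsHOMFLY F) where
  open IsHOMFLY isHOMFLY

  resp-≃ : ∀ {m} (l : List (Gen m)) {x y} → x ≃ y → F m (l ++ x) ≈₂ F m (l ++ y)
  resp-≃ l ≃-refl a b = refl
  resp-≃ l (≃-sym e) a b = sym (resp-≃ l e a b)
  resp-≃ l (≃-trans e f) a b = trans (resp-≃ l e a b) (resp-≃ l f a b)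
  resp-≃ {m} l (≃-cons g {x} {y} e) a b =
    subst₂ (λ u v → coeff2 (F m u) a b ≡ coeff2 (F m v) a b)
      (ListP.++-assoc l (g ∷ []) x) (ListP.++-assoc l (g ∷ []) y) (resp-≃ (l ++ g ∷ []) e a b)
  resp-≃ l (≃-cancel⁺⁻ i x) = cancel⁺⁻ _ l x i
  resp-≃ l (≃-cancel⁻⁺ i x) = cancel⁻⁺ _ l x i
  resp-≃ l (≃-far i j x p) = far _ l x i j p
  resp-≃ l (≃-braid i j x p) = braid _ l x i j p

  -- Coefficients of F m x, with the degree in a counted from the Morton–Franks–Williams bound m - writhe x;
  -- in this normalisation the skein relation does not shift d.
  coeffAt : ∀ m → List (Gen m) → ℤ → ℤ → ℤ
  coeffAt m x d j = coeff2 (F m x) (+ m ℤ.- writhe x + d) j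

  coeffAt-≃ : ∀ {m} {x y : List (Gen m)} → x ≃ y → ∀ d j → coeffAt m x d j ≡ coeffAt m y d j
  coeffAt-≃ {m} {x} {y} e d j = trans (resp-≃ [] e _ j)
    (cong (λ w → coeff2 (F m y) (+ m ℤ.- w + d) j) (writhe-≃ e))

  coeffAt-conj : ∀ {m} (x y : List (Gen m)) d j → coeffAt m (x ++ y) d j ≡ coeffAt m (y ++ x) d j
  coeffAt-conj {m} x y d j = trans (conj m x y _ j) (cong (λ w → coeff2 (F m (y ++ x)) (+ m ℤ.- w + d) j)
    (trans (writhe-++ x y) (trans (ℤP.+-comm (writhe x) _) (sym (writhe-++ y x)))))

  coeffAt-skein : ∀ {m} (x y : List (Gen m)) i d j →
    coeffAt m (x ++ σ⁺ i ∷ y) d j ≡ coeffAt m (x ++ σ⁻ i ∷ y) d j + coeffAt m (x ++ y) d (j ℤ.- 1ℤ)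
  coeffAt-skein {m} x y i d j = begin
    coeffAt m (x ++ σ⁺ i ∷ y) d j                ≡⟨ cong₂ (coeff2 (F m (x ++ σ⁺ i ∷ y))) deg₊ (sym (j-0 j)) ⟩
    P₊                                           ≡⟨ split P₊ P₋ ⟩
    P₋ + (P₊ + - P₋)                             ≡⟨ cong₂ _+_ (cong₂ (coeff2 (F m (x ++ σ⁻ i ∷ y))) deg₋ (j-0 j)) rel ⟩
    coeffAt m (x ++ σ⁻ i ∷ y) d j + coeff2 (F m (x ++ y)) (a ℤ.- 0ℤ) (j ℤ.- 1ℤ)
      ≡⟨ cong (λ u → coeffAt m (x ++ σ⁻ i ∷ y) d j + coeff2 (F m (x ++ y)) u (j ℤ.- 1ℤ)) (j-0 a) ⟩
    coeffAt m (x ++ σ⁻ i ∷ y) d j + coeffAt m (x ++ y) d (j ℤ.- 1ℤ) ∎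
    where
    open ≡-Reasoning
    a = + m ℤ.- writhe (x ++ y) + d
    P₊ = coeff2 (F m (x ++ σ⁺ i ∷ y)) (a ℤ.- + 1) (j ℤ.- 0ℤ)
    P₋ = coeff2 (F m (x ++ σ⁻ i ∷ y)) (a ℤ.- (- + 1)) (j ℤ.- 0ℤ)
    j-0 : ∀ j → j ℤ.- 0ℤ ≡ j
    j-0 = solve-∀
    split : ∀ p q → p ≡ q + (p + - q)
    split = solve-∀
    deg₊ : + m ℤ.- writhe (x ++ σ⁺ i ∷ y) + d ≡ a ℤ.- + 1
    deg₊ = trans (cong (λ w → + m ℤ.- w + d) (writhe-++ x (σ⁺ i ∷ y)))
      (trans (arith (+ m) (writhe x) (writhe y) d) (cong (λ w → + m ℤ.- w + d ℤ.- + 1) (sym (writhe-++ x y))))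
      where
      arith : ∀ m x y d → m ℤ.- (x + (1ℤ + y)) + d ≡ m ℤ.- (x + y) + d ℤ.- 1ℤ
      arith = solve-∀
    deg₋ : a ℤ.- (- + 1) ≡ + m ℤ.- writhe (x ++ σ⁻ i ∷ y) + d
    deg₋ = trans (cong (λ w → + m ℤ.- w + d ℤ.- (- + 1)) (writhe-++ x y))
      (trans (arith (+ m) (writhe x) (writhe y) d) (cong (λ w → + m ℤ.- w + d) (sym (writhe-++ x (σ⁻ i ∷ y)))))
      where
      arith : ∀ m x y d → m ℤ.- (x + y) + d ℤ.- (- 1ℤ) ≡ m ℤ.- (x + (- 1ℤ + y)) + d
      arith = solve-∀
    rel : P₊ + - P₋ ≡ coeff2 (F m (x ++ y)) (a ℤ.- 0ℤ) (j ℤ.- 1ℤ)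
    rel = begin
      P₊ + - P₋ ≡⟨ cong₂ _+_ (sym (coeff2-monMul2 (+ 1) 0ℤ (F m (x ++ σ⁺ i ∷ y)) a j))
                    (cong -_ (sym (coeff2-monMul2 (- + 1) 0ℤ (F m (x ++ σ⁻ i ∷ y)) a j))) ⟩
      coeff2 A a j + - coeff2 B a j    ≡⟨ cong (λ u → coeff2 A a j + u) (sym (coeff2-neg2 B a j)) ⟩
      coeff2 A a j + coeff2 (neg2 B) a j ≡⟨ sym (coeff2-++ A (neg2 B) a j) ⟩
      coeff2 (A ++ neg2 B) a j         ≡⟨ skein m x y i a j ⟩
      coeff2 (monMul2 0ℤ (+ 1) (F m (x ++ y))) a j ≡⟨ coeff2-monMul2 0ℤ (+ 1) (F m (x ++ y)) a j ⟩
      coeff2 (F m (x ++ y)) (a ℤ.- 0ℤ) (j ℤ.- 1ℤ) ∎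
      where
      A = monMul2 (+ 1) 0ℤ (F m (x ++ σ⁺ i ∷ y))
      B = monMul2 (- + 1) 0ℤ (F m (x ++ σ⁻ i ∷ y))

  coeffAt-stab⁺ : ∀ {m} (x : List (Gen m)) d j →
    coeffAt (suc m) (map liftG x ++ σ⁺ (fromℕ m) ∷ []) d j ≡ coeffAt m x d j
  coeffAt-stab⁺ {m} x d j = trans (stab⁺ m x _ j) (cong (λ a → coeff2 (F m x) a j)
    (trans (cong (λ w → + suc m ℤ.- w + d) (trans (writhe-++ (map liftG x) _) (cong (λ u → u + 1ℤ) (writhe-liftG x))))
      (arith (+ m) (writhe x) d)))
    where
    arith : ∀ m x d → (1ℤ + m) ℤ.- (x + 1ℤ) + d ≡ m ℤ.- x + d
    arith = solve-∀

  -- The bound m - writhe rises by 2, as m rises and the writhe falls by one, while the polynomial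
  -- stays the same.
  coeffAt-stab⁻ : ∀ {m} (x : List (Gen m)) d j →
    coeffAt (suc m) (map liftG x ++ σ⁻ (fromℕ m) ∷ []) d j ≡ coeffAt m x (+ 2 + d) j
  coeffAt-stab⁻ {m} x d j = trans (stab⁻ m x _ j) (cong (λ a → coeff2 (F m x) a j)
    (trans (cong (λ w → + suc m ℤ.- w + d) (trans (writhe-++ (map liftG x) _) (cong (λ u → u + - 1ℤ) (writhe-liftG x))))
      (arith (+ m) (writhe x) d)))
    where
    arith : ∀ m x d → (1ℤ + m) ℤ.- (x + - 1ℤ) + d ≡ m ℤ.- x + (+ 2 + d)
    arith = solve-∀

  -- Skein relation at a crossing with the new strand: the two signed crossings are stabilisations
  -- of `x`, and the resolution is `x` with a split unknot. Solving for the latter divides by z.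
  coeffAt-liftG : ∀ {m} (x : List (Gen m)) d j →
    coeffAt (suc m) (map liftG x) d j ≡ coeffAt m x d (j ℤ.- - 1ℤ) ℤ.- coeffAt m x (+ 2 + d) (j ℤ.- - 1ℤ)
  coeffAt-liftG {m} x d j = begin
    coeffAt (suc m) (map liftG x) d j ≡⟨ cong₂ (λ u v → coeffAt (suc m) u d v) (sym (ListP.++-identityʳ (map liftG x))) (arith j) ⟩
    c₀                                ≡⟨ split c₋ c₀ ⟩
    (c₋ + c₀) ℤ.- c₋                  ≡⟨ cong (λ u → u ℤ.- c₋) (sym (coeffAt-skein (map liftG x) [] (fromℕ m) d j′)) ⟩
    coeffAt (suc m) (map liftG x ++ σ⁺ (fromℕ m) ∷ []) d j′ ℤ.- c₋
      ≡⟨ cong₂ ℤ._-_ (coeffAt-stab⁺ x d j′) (coeffAt-stab⁻ x d j′) ⟩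
    coeffAt m x d j′ ℤ.- coeffAt m x (+ 2 + d) j′ ∎
    where
    open ≡-Reasoning
    j′ = j ℤ.- - 1ℤ
    c₀ = coeffAt (suc m) (map liftG x ++ []) d (j′ ℤ.- 1ℤ)
    c₋ = coeffAt (suc m) (map liftG x ++ σ⁻ (fromℕ m) ∷ []) d j′
    arith : ∀ j → j ≡ j ℤ.- - 1ℤ ℤ.- 1ℤ
    arith = solve-∀
    split : ∀ p q → q ≡ (p + q) ℤ.- p
    split = solve-∀

  Bounded : ∀ {m} → List (Gen m) → Set
  Bounded {m} x = ∀ d j → coeffAt m x (+ suc d) j ≡ 0ℤ

  Bounded-≃ : ∀ {m} {x y : List (Gen m)} → x ≃ y → Bounded y → Bounded x
  Bounded-≃ e b d j = trans (coeffAt-≃ e (+ suc d) j) (b d j)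

  -- By the skein relation every braid is a combination of inverses of permutation braids.
  bounded-span : ∀ {m} → (∀ (c : Code m) → Bounded (invPosBraid (nf c))) → ∀ x c → Bounded (invPosBraid (nf c) ++ x)
  bounded-span base [] c = Bounded-≃ (≃-reflexive (ListP.++-identityʳ _)) (base c)
  bounded-span {m} base (g ∷ x) c = letter g
    where
    n = invPosBraid (nf c)
    from-σ⁺ : ∀ i → Bounded (n ++ σ⁺ i ∷ x) → Bounded (n ++ σ⁻ i ∷ x)
    from-σ⁺ i b d j = trans (rearrange (coeffAt-skein n x i (+ suc d) j))
        (cong₂ ℤ._-_ (b d j) (bounded-span base x c d (j ℤ.- 1ℤ)))
      where
      rearrange : ∀ {p q r} → p ≡ q + r → q ≡ p ℤ.- r
      rearrange {q = q} {r} refl = arith q r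
        where
        arith : ∀ q r → q ≡ q + r ℤ.- r
        arith = solve-∀
    from-σ⁻ : ∀ i → Bounded (n ++ σ⁻ i ∷ x) → Bounded (n ++ σ⁺ i ∷ x)
    from-σ⁻ i b d j = trans (coeffAt-skein n x i (+ suc d) j)
      (cong₂ _+_ (b d j) (bounded-span base x c d (j ℤ.- 1ℤ)))
    ascend : ∀ i c′ → i ∷ nf c ∼ nf c′ → Bounded (n ++ σ⁻ i ∷ x)
    ascend i c′ e = Bounded-≃ (≃-sym (invPosBraid-snoc (∼-sym e) x)) (bounded-span base x c′)
    descend : ∀ i c′ → nf c ∼ i ∷ nf c′ → Bounded (n ++ σ⁺ i ∷ x)
    descend i c′ e = Bounded-≃
      (≃-trans (invPosBraid-snoc e (σ⁺ i ∷ x)) (≃-prepend (invPosBraid (nf c′)) (≃-cancel⁻⁺ i x)))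
      (bounded-span base x c′)
    -- A negative letter is absorbed if s_i lengthens the normal form, a positive one cancels if s_i
    -- shortens it. In the other two cases the skein relation first flips the sign; its resolved
    -- term, like the absorbed or cancelled word, has the shorter tail `x`.
    letter : ∀ g → Bounded (n ++ g ∷ x)
    letter (σ⁺ i) with step i c
    ... | up c′ e = from-σ⁻ i (ascend i c′ e)
    ... | down c′ e = descend i c′ e
    letter (σ⁻ i) with step i c
    ... | up c′ e = ascend i c′ e
    ... | down c′ e = from-σ⁺ i (descend i c′ e)

  invPosBraid-none : ∀ {m} (c : Code m) → invPosBraid (nf (none ▸ c)) ≡ map liftG (invPosBraid (nf c))
  invPosBraid-none c = invPosBraid-inject₁ (nf c)

  -- The word is U top W with `U` and `W` lifted from m + 1 strands; it is conjugate to W U top,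
  -- which is a negative stabilisation.
  coeffAt-ext : ∀ {m} (r : Run m) (c : Code m) d j →
    coeffAt (suc m) (invPosBraid (nf (ext r ▸ c))) d j
      ≡ coeffAt m (invPosBraid (runWord r) ++ invPosBraid (nf c)) (+ 2 + d) j
  coeffAt-ext {m} r c d j = begin
    coeffAt (suc m) (invPosBraid (nf (ext r ▸ c))) d j ≡⟨ cong (λ x → coeffAt (suc m) x d j) word ⟩
    coeffAt (suc m) ((U ++ top) ++ W) d j              ≡⟨ coeffAt-conj (U ++ top) W d j ⟩
    coeffAt (suc m) (W ++ (U ++ top)) d j
      ≡⟨ cong (λ x → coeffAt (suc m) x d j) (trans (sym (ListP.++-assoc W U top))
          (cong (_++ top) (sym (ListP.map-++ liftG (invPosBraid (runWord r)) (invPosBraid (nf c)))))) ⟩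
    coeffAt (suc m) (map liftG (invPosBraid (runWord r) ++ invPosBraid (nf c)) ++ top) d j
      ≡⟨ coeffAt-stab⁻ (invPosBraid (runWord r) ++ invPosBraid (nf c)) d j ⟩
    coeffAt m (invPosBraid (runWord r) ++ invPosBraid (nf c)) (+ 2 + d) j ∎
    where
    open ≡-Reasoning
    top = σ⁻ (fromℕ m) ∷ []
    U = map liftG (invPosBraid (nf c))
    W = map liftG (invPosBraid (runWord r))
    word : invPosBraid (nf (ext r ▸ c)) ≡ (U ++ top) ++ W
    word = trans (invPosBraid-++ (runWord (ext r)) (map inject₁ (nf c)))
      (trans (cong₂ _++_ (invPosBraid-inject₁ (nf c))
          (trans (invPosBraid-++ (map inject₁ (runWord r)) (fromℕ m ∷ []))
            (cong (top ++_) (invPosBraid-inject₁ (runWord r)))))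
        (sym (ListP.++-assoc U top W)))

  -- Induction on the number of strands: `base` reduces each spanning braid to braids on one strand
  -- fewer, and `bounded-span` is started at the empty normal form.
  bounded : ∀ {m} (x : List (Gen m)) → Bounded x
  bounded {zero} [] d j = unknot (+ suc d) j
  bounded {zero} (σ⁺ () ∷ _)
  bounded {zero} (σ⁻ () ∷ _)
  bounded {suc m} x = Bounded-≃ (≃-reflexive (cong (λ ws → invPosBraid ws ++ x) (sym (nf-identity (suc m)))))
    (bounded-span base x (identity (suc m)))
    where
    base : ∀ (c : Code (suc m)) → Bounded (invPosBraid (nf c))
    base (none ▸ c) d j = trans (cong (λ x → coeffAt (suc m) x (+ suc d) j) (invPosBraid-none c))
      (trans (coeffAt-liftG (invPosBraid (nf c)) (+ suc d) j)
        (cong₂ ℤ._-_ (bounded (invPosBraid (nf c)) d _) (bounded (invPosBraid (nf c)) (suc (suc d)) _)))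
    base (ext r ▸ c) d j = trans (coeffAt-ext r c (+ suc d) j) (bounded _ (suc (suc d)) j)

  -- The negative stabilisation is read 2 above the bound and vanishes, so in top degree a split
  -- strand contributes just the factor z⁻¹.
  coeffAt-liftG-top : ∀ {m} (x : List (Gen m)) j → coeffAt (suc m) (map liftG x) 0ℤ j ≡ coeffAt m x 0ℤ (j ℤ.- - 1ℤ)
  coeffAt-liftG-top {m} x j = trans (coeffAt-liftG x 0ℤ j)
    (trans (cong (λ u → coeffAt m x 0ℤ (j ℤ.- - 1ℤ) ℤ.- u) (bounded x 1 _)) (ℤP.+-identityʳ _))

  coeffAt-unlink : ∀ m j → coeffAt m [] 0ℤ j ≡ zCoeff m (0 ∷ []) j
  coeffAt-unlink zero j = unknot 0ℤ j
  coeffAt-unlink (suc m) j = trans (coeffAt-liftG-top {m} [] j)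
    (trans (coeffAt-unlink m (j ℤ.- - 1ℤ))
      (sym (zCoeff-shift {m} {suc m} {(- 1ℤ)} id (λ k → arith (+ k) (+ m)) (0 ∷ []) j)))
    where
    arith : ∀ k m → k ℤ.- m + - 1ℤ ≡ k ℤ.- (1ℤ + m)
    arith = solve-∀

  -- The counterpart of R_v^1 = 0 for v ≠ 1: once the last generator occurs, the coefficient is one
  -- that lies 2 above the bound on fewer strands.
  coeffAt-invPosBraid : ∀ {m} (c : Code m) →
    nf c ≡ [] ⊎ (nf c ≢ [] × (∀ j → coeffAt m (invPosBraid (nf c)) 0ℤ j ≡ 0ℤ))
  coeffAt-invPosBraid trivial = inj₁ refl
  coeffAt-invPosBraid (none ▸ c) with coeffAt-invPosBraid c
  ... | inj₁ e = inj₁ (cong (map inject₁) e)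
  ... | inj₂ (ne , z) = inj₂ (ne ∘ ListP.map-injective FinP.inject₁-injective , λ j →
          trans (cong (λ x → coeffAt _ x 0ℤ j) (invPosBraid-none c)) (trans (coeffAt-liftG-top (invPosBraid (nf c)) j) (z _)))
  coeffAt-invPosBraid (ext {m} r ▸ c) = inj₂
    ( (λ e → contradiction (ListP.++-conicalʳ (map inject₁ (runWord r)) _
               (ListP.++-conicalˡ (runWord (ext r)) _ e)) λ ())
    , λ j → trans (coeffAt-ext r c 0ℤ j) (bounded (invPosBraid (runWord r) ++ invPosBraid (nf c)) 1 j))

-- Laurent polynomials in t

-- A wrapper of _≈₁_ from which Agda can infer p and r.
infix 4 _≋_
record _≋_ (p r : LP1) : Set where
  constructor coeffs
  field at : p ≈₁ r

open _≋_

coeff1-++ : ∀ p r k → coeff1 (p ++ r) k ≡ coeff1 p k + coeff1 r k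
coeff1-++ [] r k = sym (ℤP.+-identityˡ _)
coeff1-++ ((e , c) ∷ p) r k = trans
  (cong (λ u → (if does (e ℤ.≟ k) then c else 0ℤ) + u) (coeff1-++ p r k))
  (sym (ℤP.+-assoc (if does (e ℤ.≟ k) then c else 0ℤ) _ _))

-- The linear functional t^e ↦ h(e) applied to the polynomial. The coefficients of products and of
-- `topSubst` are both of this form.
pairing : LP1 → (ℤ → ℤ) → ℤ
pairing [] h = 0ℤ
pairing ((e , c) ∷ p) h = c ℤ.* h e + pairing p h

pairing-++ : ∀ p r h → pairing (p ++ r) h ≡ pairing p h + pairing r h
pairing-++ [] r h = sym (ℤP.+-identityˡ _)
pairing-++ ((e , c) ∷ p) r h = trans (cong (λ u → c ℤ.* h e + u) (pairing-++ p r h)) (sym (ℤP.+-assoc (c ℤ.* h e) _ _))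

pairing-cong : ∀ p {g h} → (∀ e → g e ≡ h e) → pairing p g ≡ pairing p h
pairing-cong [] eq = refl
pairing-cong ((e , c) ∷ p) eq = cong₂ _+_ (cong (c ℤ.*_) (eq e)) (pairing-cong p eq)

pairing-+ : ∀ p g h → pairing p (λ e → g e + h e) ≡ pairing p g + pairing p h
pairing-+ [] g h = refl
pairing-+ ((e , c) ∷ p) g h = trans (cong (λ u → c ℤ.* (g e + h e) + u) (pairing-+ p g h))
  (arith c (g e) (h e) (pairing p g) (pairing p h))
  where
  arith : ∀ c a b x y → c ℤ.* (a + b) + (x + y) ≡ (c ℤ.* a + x) + (c ℤ.* b + y)
  arith = solve-∀

pairing-zero : ∀ p → pairing p (λ _ → 0ℤ) ≡ 0ℤ
pairing-zero [] = refl
pairing-zero ((e , c) ∷ p) = cong₂ _+_ (ℤP.*-zeroʳ c) (pairing-zero p)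

pairing-indicator : ∀ p c e → pairing p (λ f → if does (e ℤ.≟ f) then c else 0ℤ) ≡ c ℤ.* coeff1 p e
pairing-indicator [] c e = sym (ℤP.*-zeroʳ c)
pairing-indicator ((f , d) ∷ p) c e
  rewrite does-⇔ (mk⇔ sym sym) (e ℤ.≟ f) (f ℤ.≟ e) with does (f ℤ.≟ e)
... | true = trans (cong (λ u → d ℤ.* c + u) (pairing-indicator p c e)) (arith c d (coeff1 p e))
  where
  arith : ∀ c d x → d ℤ.* c + c ℤ.* x ≡ c ℤ.* (d + x)
  arith = solve-∀
... | false = trans (cong (λ u → d ℤ.* 0ℤ + u) (pairing-indicator p c e)) (arith c d (coeff1 p e))
  where
  arith : ∀ c d x → d ℤ.* 0ℤ + c ℤ.* x ≡ c ℤ.* (0ℤ + x)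
  arith = solve-∀

remove : ℤ → LP1 → LP1
remove e [] = []
remove e ((f , d) ∷ p) = if does (f ℤ.≟ e) then remove e p else (f , d) ∷ remove e p

remove-length : ∀ e p → length (remove e p) ℕ.≤ length p
remove-length e [] = z≤n
remove-length e ((f , d) ∷ p) with does (f ℤ.≟ e)
... | true = ℕP.m≤n⇒m≤1+n (remove-length e p)
... | false = s≤s (remove-length e p)

remove-coeff-self : ∀ e p → coeff1 (remove e p) e ≡ 0ℤ
remove-coeff-self e [] = refl
remove-coeff-self e ((f , d) ∷ p) with f ℤ.≟ e
... | yes _ = remove-coeff-self e p
... | no f≢e rewrite dec-false (f ℤ.≟ e) f≢e = trans (ℤP.+-identityˡ _) (remove-coeff-self e p)

remove-coeff-other : ∀ {e k} → e ≢ k → ∀ p → coeff1 (remove e p) k ≡ coeff1 p k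
remove-coeff-other e≢k [] = refl
remove-coeff-other {e} {k} e≢k ((f , d) ∷ p) with f ℤ.≟ e
... | yes refl rewrite dec-false (f ℤ.≟ k) e≢k = trans (remove-coeff-other e≢k p) (sym (ℤP.+-identityˡ _))
... | no _ = cong (λ u → (if does (f ℤ.≟ k) then d else 0ℤ) + u) (remove-coeff-other e≢k p)

remove-pairing : ∀ e p h → pairing p h ≡ coeff1 p e ℤ.* h e + pairing (remove e p) h
remove-pairing e [] h = refl
remove-pairing e ((f , d) ∷ p) h with f ℤ.≟ e
... | yes refl = trans (cong (λ u → d ℤ.* h f + u) (remove-pairing f p h)) (arith d (h f) (coeff1 p f) _)
  where
  arith : ∀ d h x y → d ℤ.* h + (x ℤ.* h + y) ≡ (d + x) ℤ.* h + y
  arith = solve-∀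
... | no _ = trans (cong (λ u → d ℤ.* h f + u) (remove-pairing e p h)) (arith (d ℤ.* h f) (h e) (coeff1 p e) _)
  where
  arith : ∀ d h x y → d + (x ℤ.* h + y) ≡ (0ℤ + x) ℤ.* h + (d + y)
  arith = solve-∀

-- The tail of a formal sum with zero coefficients need not have zero coefficients. Hence all terms
-- sharing the first exponent are removed together, with induction on the bound `n` for the number
-- of terms.
pairing-null : ∀ n p → length p ℕ.≤ n → (∀ k → coeff1 p k ≡ 0ℤ) → ∀ h → pairing p h ≡ 0ℤ
pairing-null n [] _ z h = refl
pairing-null (suc n) p@((e , c) ∷ p′) (s≤s l) z h = begin
  pairing p h                                   ≡⟨ remove-pairing e p h ⟩
  coeff1 p e ℤ.* h e + pairing (remove e p) h   ≡⟨ cong₂ (λ x y → x ℤ.* h e + y) (z e)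
                                                    (pairing-null n (remove e p) shorter null h) ⟩
  0ℤ                                            ∎
  where
  open ≡-Reasoning
  shorter : length (remove e p) ℕ.≤ n
  shorter rewrite dec-true (e ℤ.≟ e) refl = ℕP.≤-trans (remove-length e p′) l
  null : ∀ k → coeff1 (remove e p) k ≡ 0ℤ
  null k with e ℤ.≟ k
  ... | yes refl = remove-coeff-self e p
  ... | no e≢k = trans (remove-coeff-other e≢k p) (z k)

scale1-coeff : ∀ c p k → coeff1 (scale1 c p) k ≡ c ℤ.* coeff1 p k
scale1-coeff c [] k = sym (ℤP.*-zeroʳ c)
scale1-coeff c ((e , d) ∷ p) k with does (e ℤ.≟ k)
... | true = trans (cong (λ u → c ℤ.* d + u) (scale1-coeff c p k)) (sym (ℤP.*-distribˡ-+ c d _))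
... | false = trans (cong (λ u → 0ℤ + u) (scale1-coeff c p k)) (arith c (coeff1 p k))
  where
  arith : ∀ c x → 0ℤ + c ℤ.* x ≡ c ℤ.* (0ℤ + x)
  arith = solve-∀

scale1-pairing : ∀ c p h → pairing (scale1 c p) h ≡ c ℤ.* pairing p h
scale1-pairing c [] h = sym (ℤP.*-zeroʳ c)
scale1-pairing c ((e , d) ∷ p) h = trans (cong (λ u → c ℤ.* d ℤ.* h e + u) (scale1-pairing c p h))
  (arith c d (h e) (pairing p h))
  where
  arith : ∀ c d h x → c ℤ.* d ℤ.* h + c ℤ.* x ≡ c ℤ.* (d ℤ.* h + x)
  arith = solve-∀

pairing-resp-≋ : ∀ {p r} → p ≋ r → ∀ h → pairing p h ≡ pairing r h
pairing-resp-≋ {p} {r} eq h = begin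
  pairing p h                               ≡⟨ arith (pairing p h) (pairing r h) ⟩
  pairing p h + - 1ℤ ℤ.* pairing r h + pairing r h
    ≡⟨ cong (λ u → pairing p h + u + pairing r h) (sym (scale1-pairing (- 1ℤ) r h)) ⟩
  pairing p h + pairing (scale1 (- 1ℤ) r) h + pairing r h ≡⟨ cong (λ u → u + pairing r h) (sym (pairing-++ p _ h)) ⟩
  pairing d h + pairing r h                 ≡⟨ cong (λ u → u + pairing r h) (pairing-null (length d) d ℕP.≤-refl null h) ⟩
  0ℤ + pairing r h                          ≡⟨ ℤP.+-identityˡ _ ⟩
  pairing r h                               ∎
  where
  open ≡-Reasoning
  d = p ++ scale1 (- 1ℤ) r
  arith : ∀ x y → x ≡ x + - 1ℤ ℤ.* y + y
  arith = solve-∀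
  null : ∀ k → coeff1 d k ≡ 0ℤ
  null k = trans (coeff1-++ p _ k) (trans (cong₂ _+_ (eq .at k) (scale1-coeff (- 1ℤ) r k)) (cancel (coeff1 r k)))
    where
    cancel : ∀ x → x + - 1ℤ ℤ.* x ≡ 0ℤ
    cancel = solve-∀

coeff1-shift : ∀ e c p k → coeff1 (map (λ { (f , d) → (e + f , c ℤ.* d) }) p) k ≡ c ℤ.* coeff1 p (k ℤ.- e)
coeff1-shift e c [] k = sym (ℤP.*-zeroʳ c)
coeff1-shift e c ((f , d) ∷ p) k
  rewrite ℤP.+-comm e f | does-⇔ (+-shift-⇔ f k e) (f + e ℤ.≟ k) (f ℤ.≟ k ℤ.- e) with does (f ℤ.≟ k ℤ.- e)
... | true = trans (cong (λ u → c ℤ.* d + u) (coeff1-shift e c p k)) (sym (ℤP.*-distribˡ-+ c d _))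
... | false = trans (cong (λ u → 0ℤ + u) (coeff1-shift e c p k)) (arith c (coeff1 p (k ℤ.- e)))
  where
  arith : ∀ c x → 0ℤ + c ℤ.* x ≡ c ℤ.* (0ℤ + x)
  arith = solve-∀

pairing-shift : ∀ e c p h → pairing (map (λ { (f , d) → (e + f , c ℤ.* d) }) p) h ≡ c ℤ.* pairing p (λ f → h (e + f))
pairing-shift e c [] h = sym (ℤP.*-zeroʳ c)
pairing-shift e c ((f , d) ∷ p) h = trans (cong (λ u → c ℤ.* d ℤ.* h (e + f) + u) (pairing-shift e c p h))
  (arith c d (h (e + f)) _)
  where
  arith : ∀ c d h x → c ℤ.* d ℤ.* h + c ℤ.* x ≡ c ℤ.* (d ℤ.* h + x)
  arith = solve-∀

*₁-coeff : ∀ p r k → coeff1 (p *₁ r) k ≡ pairing p (λ e → coeff1 r (k ℤ.- e))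
*₁-coeff [] r k = refl
*₁-coeff ((e , c) ∷ p) r k =
  trans (coeff1-++ (map (λ { (f , d) → (e + f , c ℤ.* d) }) r) (p *₁ r) k)
    (cong₂ _+_ (coeff1-shift e c r k) (*₁-coeff p r k))

*₁-pairing : ∀ p r h → pairing (p *₁ r) h ≡ pairing p (λ e → pairing r (λ f → h (e + f)))
*₁-pairing [] r h = refl
*₁-pairing ((e , c) ∷ p) r h =
  trans (pairing-++ (map (λ { (f , d) → (e + f , c ℤ.* d) }) r) (p *₁ r) h)
    (cong₂ _+_ (pairing-shift e c r h) (*₁-pairing p r h))

-- Ring laws up to equality of coefficients

≋-refl : ∀ {p} → p ≋ p
≋-refl = coeffs λ _ → refl

≋-reflexive : ∀ {p r} → p ≡ r → p ≋ r
≋-reflexive refl = ≋-refl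

≋-sym : ∀ {p r} → p ≋ r → r ≋ p
≋-sym e = coeffs λ k → sym (e .at k)

≋-trans : ∀ {p q r} → p ≋ q → q ≋ r → p ≋ r
≋-trans e f = coeffs λ k → trans (e .at k) (f .at k)

+₁-cong : ∀ {p p′ r r′} → p ≋ p′ → r ≋ r′ → p +₁ r ≋ p′ +₁ r′
+₁-cong {p} {p′} e f = coeffs λ k →
  trans (coeff1-++ p _ k) (trans (cong₂ _+_ (e .at k) (f .at k)) (sym (coeff1-++ p′ _ k)))

*₁-comm : ∀ p r → p *₁ r ≋ r *₁ p
*₁-comm p r = coeffs λ k → trans (*₁-coeff p r k) (trans (exchange p k) (sym (*₁-coeff r p k)))
  where
  exchange : ∀ p k → pairing p (λ e → coeff1 r (k ℤ.- e)) ≡ pairing r (λ f → coeff1 p (k ℤ.- f))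
  exchange [] k = sym (pairing-zero r)
  exchange ((e , c) ∷ p) k = begin
    c ℤ.* coeff1 r (k ℤ.- e) + pairing p (λ e → coeff1 r (k ℤ.- e))
      ≡⟨ cong₂ _+_ (sym (pairing-indicator r c (k ℤ.- e))) (exchange p k) ⟩
    pairing r (λ f → if does (k ℤ.- e ℤ.≟ f) then c else 0ℤ) + pairing r (λ f → coeff1 p (k ℤ.- f))
      ≡⟨ cong (λ u → u + pairing r (λ f → coeff1 p (k ℤ.- f))) (pairing-cong r λ f →
          cong (if_then c else 0ℤ) (does-⇔ (mk⇔ (flip k e f) (sym ∘ flip k f e ∘ sym)) (k ℤ.- e ℤ.≟ f) (e ℤ.≟ k ℤ.- f))) ⟩
    pairing r (λ f → if does (e ℤ.≟ k ℤ.- f) then c else 0ℤ) + pairing r (λ f → coeff1 p (k ℤ.- f))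
      ≡⟨ sym (pairing-+ r _ _) ⟩
    pairing r (λ f → coeff1 ((e , c) ∷ p) (k ℤ.- f)) ∎
    where
    open ≡-Reasoning
    flip : ∀ k e f → k ℤ.- e ≡ f → e ≡ k ℤ.- f
    flip k e .(k ℤ.- e) refl = arith k e
      where
      arith : ∀ k e → e ≡ k ℤ.- (k ℤ.- e)
      arith = solve-∀

*₁-congˡ : ∀ p {r r′} → r ≋ r′ → p *₁ r ≋ p *₁ r′
*₁-congˡ p {r} {r′} e = coeffs λ k →
  trans (*₁-coeff p r k) (trans (pairing-cong p (λ f → e .at (k ℤ.- f))) (sym (*₁-coeff p r′ k)))

-- `*₁-coeff` expands along the left factor, so congruence is immediate only on the right;
-- commutativity transfers it to the left.
*₁-cong : ∀ {p p′ r r′} → p ≋ p′ → r ≋ r′ → p *₁ r ≋ p′ *₁ r′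
*₁-cong {p} {p′} {r} {r′} e f = ≋-trans (*₁-congˡ p f) (≋-trans (*₁-comm p r′)
  (≋-trans (*₁-congˡ r′ e) (*₁-comm r′ p′)))

*₁-assoc : ∀ p q r → (p *₁ q) *₁ r ≋ p *₁ (q *₁ r)
*₁-assoc p q r = coeffs λ k → begin
  coeff1 ((p *₁ q) *₁ r) k                                       ≡⟨ *₁-coeff (p *₁ q) r k ⟩
  pairing (p *₁ q) (λ e → coeff1 r (k ℤ.- e))                     ≡⟨ *₁-pairing p q _ ⟩
  pairing p (λ e → pairing q (λ f → coeff1 r (k ℤ.- (e + f))))
    ≡⟨ pairing-cong p (λ e → trans (pairing-cong q (λ f → cong (coeff1 r) (arith k e f))) (sym (*₁-coeff q r (k ℤ.- e)))) ⟩
  pairing p (λ e → coeff1 (q *₁ r) (k ℤ.- e))                     ≡⟨ sym (*₁-coeff p (q *₁ r) k) ⟩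
  coeff1 (p *₁ (q *₁ r)) k                                        ∎
  where
  open ≡-Reasoning
  arith : ∀ k e f → k ℤ.- (e + f) ≡ k ℤ.- e ℤ.- f
  arith = solve-∀

*₁-identityˡ : ∀ p → one1 *₁ p ≋ p
*₁-identityˡ p = coeffs λ k → trans (*₁-coeff one1 p k)
  (trans (arith (coeff1 p (k ℤ.- 0ℤ))) (cong (coeff1 p) (ℤP.+-identityʳ k)))
  where
  arith : ∀ x → 1ℤ ℤ.* x + 0ℤ ≡ x
  arith = solve-∀

*₁-identityʳ : ∀ p → p *₁ one1 ≋ p
*₁-identityʳ p = ≋-trans (*₁-comm p one1) (*₁-identityˡ p)

*₁-distribˡ-+₁ : ∀ p q r → p *₁ (q +₁ r) ≋ p *₁ q +₁ p *₁ r
*₁-distribˡ-+₁ p q r = coeffs λ k → begin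
  coeff1 (p *₁ (q ++ r)) k                                ≡⟨ *₁-coeff p (q ++ r) k ⟩
  pairing p (λ e → coeff1 (q ++ r) (k ℤ.- e))              ≡⟨ pairing-cong p (λ e → coeff1-++ q r (k ℤ.- e)) ⟩
  pairing p (λ e → coeff1 q (k ℤ.- e) + coeff1 r (k ℤ.- e)) ≡⟨ pairing-+ p _ _ ⟩
  pairing p (λ e → coeff1 q (k ℤ.- e)) + pairing p (λ e → coeff1 r (k ℤ.- e))
    ≡⟨ cong₂ _+_ (sym (*₁-coeff p q k)) (sym (*₁-coeff p r k)) ⟩
  coeff1 (p *₁ q) k + coeff1 (p *₁ r) k                    ≡⟨ sym (coeff1-++ (p *₁ q) (p *₁ r) k) ⟩
  coeff1 (p *₁ q ++ p *₁ r) k                              ∎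
  where open ≡-Reasoning

*₁-zeroʳ : ∀ p → p *₁ zero1 ≋ zero1
*₁-zeroʳ p = *₁-comm p zero1

*₁-commutativeMonoid : CommutativeMonoid _ _
*₁-commutativeMonoid = record
  { Carrier = LP1 ; _≈_ = _≋_ ; _∙_ = _*₁_ ; ε = one1
  ; isCommutativeMonoid = record
    { isMonoid = record
      { isSemigroup = record
        { isMagma = record
          { isEquivalence = record { refl = ≋-refl ; sym = ≋-sym ; trans = ≋-trans }
          ; ∙-cong = *₁-cong }
        ; assoc = *₁-assoc }
      ; identity = *₁-identityˡ , *₁-identityʳ }
    ; comm = *₁-comm } }

open CommutativeSemigroupP (CommutativeMonoid.commutativeSemigroup *₁-commutativeMonoid)
  using (interchange; x∙yz≈y∙xz)
module ≋-Reasoning = SetoidReasoning (CommutativeMonoid.setoid *₁-commutativeMonoid)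

-- Powers of t and of u = t - t⁻¹

pow1-+ : ∀ p a b → pow1 p a *₁ pow1 p b ≋ pow1 p (a ℕ.+ b)
pow1-+ p zero b = *₁-identityˡ (pow1 p b)
pow1-+ p (suc a) b = ≋-trans (*₁-assoc p (pow1 p a) (pow1 p b)) (*₁-congˡ p (pow1-+ p a b))

pow1-* : ∀ p r n → pow1 (p *₁ r) n ≋ pow1 p n *₁ pow1 r n
pow1-* p r zero = ≋-refl
pow1-* p r (suc n) = ≋-trans (*₁-congˡ (p *₁ r) (pow1-* p r n)) (interchange p r (pow1 p n) (pow1 r n))

pow1-mon1 : ∀ n → pow1 (mon1 1ℤ 1ℤ) n ≋ mon1 (+ n) 1ℤ
pow1-mon1 zero = ≋-refl
pow1-mon1 (suc n) = *₁-congˡ (mon1 1ℤ 1ℤ) (pow1-mon1 n)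

mon1-* : ∀ a b {c} → a + b ≡ c → mon1 a 1ℤ *₁ mon1 b 1ℤ ≋ mon1 c 1ℤ
mon1-* a b refl = ≋-refl

-- Since q - 1 = t (t - t⁻¹).
pow1-qMinus1 : ∀ n → pow1 qMinus1 n ≋ mon1 (+ n) 1ℤ *₁ pow1 uvar n
pow1-qMinus1 n = ≋-trans (pow1-* (mon1 1ℤ 1ℤ) uvar n) (*₁-cong (pow1-mon1 n) ≋-refl)

-- Exponents are taken without the shift by -m: this is z^m times the top coefficient at z = t -
-- t⁻¹.
evalU : List ℕ → LP1
evalU = concatMap (pow1 uvar)

evalU-map-suc : ∀ W → evalU (map suc W) ≋ uvar *₁ evalU W
evalU-map-suc [] = ≋-sym (*₁-zeroʳ uvar)
evalU-map-suc (k ∷ W) = ≋-trans (+₁-cong ≋-refl (evalU-map-suc W)) (≋-sym (*₁-distribˡ-+₁ uvar (pow1 uvar k) (evalU W)))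

evalU-++ : ∀ W W′ → evalU (W ++ W′) ≡ evalU W +₁ evalU W′
evalU-++ W W′ = ListP.concatMap-++ (pow1 uvar) W W′

-- With q - 1 = t u and q = t², both prefactors become t^ℓ; the lengths ℓ - 1 and ℓ - 2 are those of
-- the pairs (v, w) and (s_i v, w) against (v, s_i w).
R-recursion : ∀ ℓ A B → qMinus1 *₁ (mon1 (ℓ + - 1ℤ) 1ℤ *₁ A) +₁ qvar *₁ (mon1 (ℓ + - + 2) 1ℤ *₁ B)
  ≋ mon1 ℓ 1ℤ *₁ (uvar *₁ A +₁ B)
R-recursion ℓ A B = ≋-trans (+₁-cong
    (≋-trans (interchange (mon1 1ℤ 1ℤ) uvar (mon1 (ℓ + - 1ℤ) 1ℤ) A) (*₁-cong (mon1-* 1ℤ (ℓ + - 1ℤ) (arith₁ ℓ)) ≋-refl))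
    (≋-trans (≋-sym (*₁-assoc qvar (mon1 (ℓ + - + 2) 1ℤ) B)) (*₁-cong (mon1-* (+ 2) (ℓ + - + 2) (arith₂ ℓ)) ≋-refl)))
  (≋-sym (*₁-distribˡ-+₁ (mon1 ℓ 1ℤ) (uvar *₁ A) B))
  where
  arith₁ : ∀ ℓ → 1ℤ + (ℓ + - 1ℤ) ≡ ℓ
  arith₁ = solve-∀
  arith₂ : ∀ ℓ → + 2 + (ℓ + - + 2) ≡ ℓ
  arith₂ = solve-∀

zCoeff-++ : ∀ m W W′ j → zCoeff m (W ++ W′) j ≡ zCoeff m W j + zCoeff m W′ j
zCoeff-++ m W W′ j = trans (cong (λ p → coeff1 p j) (ListP.map-++ _ W W′)) (coeff1-++ (zTerms m W) (zTerms m W′) j)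

zCoeff-nonneg : ∀ m W j → ∃ λ n → zCoeff m W j ≡ + n
zCoeff-nonneg m [] j = 0 , refl
zCoeff-nonneg m (k ∷ W) j with does (+ k ℤ.- + m ℤ.≟ j) | zCoeff-nonneg m W j
... | true | n , e = suc n , cong (λ u → 1ℤ + u) e
... | false | n , e = n , cong (λ u → 0ℤ + u) e

-- Coefficients count occurrences, so the contribution of `k` cannot cancel.
zCoeff-∈ : ∀ {m W k} → k ∈ W → zCoeff m W (+ k ℤ.- + m) ≢ 0ℤ
zCoeff-∈ {m} {k ∷ W} (here refl) z rewrite dec-true (+ k ℤ.- + m ℤ.≟ + k ℤ.- + m) refl
  with zCoeff-nonneg m W (+ k ℤ.- + m)
... | n , e with () ← trans (sym (cong (λ u → 1ℤ + u) e)) z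
zCoeff-∈ {m} {l ∷ W} {k} (there k∈) z with does (+ l ℤ.- + m ℤ.≟ + k ℤ.- + m) | zCoeff-nonneg m W (+ k ℤ.- + m)
... | false | _ = zCoeff-∈ {m} k∈ (trans (sym (ℤP.+-identityˡ _)) z)
... | true | n , e with () ← trans (sym (cong (λ u → 1ℤ + u) e)) z

-- uvar to an integer power, with the junk value 0 for negative exponents, as in topSubst.
powU : ℤ → LP1
powU (+ k) = pow1 uvar k
powU -[1+ _ ] = []

-- Terms of other a-degree stay with coefficient 0 instead of being dropped, so that the
-- term-by-term comparisons stay aligned.
slice : ℤ → LP2 → LP1
slice κ = map (λ { (i , j , c) → (j , (if does (i ℤ.≟ κ) then c else 0ℤ)) })

slice-coeff : ∀ κ P j → coeff1 (slice κ P) j ≡ coeff2 P κ j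
slice-coeff κ [] j = refl
slice-coeff κ ((e , f , c) ∷ P) j = cong₂ _+_ (nested (does (e ℤ.≟ κ)) (does (f ℤ.≟ j))) (slice-coeff κ P j)
  where
  nested : ∀ a b → (if b then (if a then c else 0ℤ) else 0ℤ) ≡ (if a ∧ b then c else 0ℤ)
  nested false false = refl
  nested false true = refl
  nested true false = refl
  nested true true = refl

-- Shows `topSubst` to be linear in the coefficient of a^κ, so that it depends on the coefficients
-- of `P` and not on the chosen formal sum.
topSubst-coeff : ∀ N κ P k → coeff1 (topSubst N κ P) k ≡ pairing (slice κ P) (λ j → coeff1 (powU (j + + N)) k)
topSubst-coeff N κ [] k = refl
topSubst-coeff N κ ((i , j , c) ∷ P) k with does (i ℤ.≟ κ) | j ℤ.+ + N
... | true | + n = trans (coeff1-++ (scale1 c (pow1 uvar n)) _ k)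
        (cong₂ _+_ (scale1-coeff c (pow1 uvar n) k) (topSubst-coeff N κ P k))
... | true | -[1+ _ ] = trans (topSubst-coeff N κ P k) (arith c _)
  where
  arith : ∀ c x → x ≡ c ℤ.* 0ℤ + x
  arith = solve-∀
... | false | _ = trans (topSubst-coeff N κ P k) (sym (ℤP.+-identityˡ _))

topSubst-zTerms : ∀ N κ P {m W} → (∀ j → coeff2 P κ j ≡ zCoeff m W j) →
  topSubst N κ P ≋ concatMap (λ k → powU (+ k ℤ.- + m + + N)) W
topSubst-zTerms N κ P {m} {W} top = coeffs λ x → trans (topSubst-coeff N κ P x)
  (trans (pairing-resp-≋ {slice κ P} {zTerms m W} (coeffs λ j → trans (slice-coeff κ P j) (top j)) (λ j → coeff1 (powU (j + + N)) x)) (expand W x))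
  where
  expand : ∀ W x → pairing (zTerms m W) (λ j → coeff1 (powU (j + + N)) x)
    ≡ coeff1 (concatMap (λ k → powU (+ k ℤ.- + m + + N)) W) x
  expand [] x = refl
  expand (k ∷ W) x = trans (cong₂ _+_ (ℤP.*-identityˡ (coeff1 (powU (+ k ℤ.- + m + + N)) x)) (expand W x))
    (sym (coeff1-++ (powU (+ k ℤ.- + m + + N)) _ x))

-- Termwise this is u^N u^k = u^m u^{k-m+N}; the hypothesis keeps the junk value of `powU` out.
evalU-shift : ∀ N m W → (∀ {k} → k ∈ W → 0ℤ ℤ.≤ + k ℤ.- + m + + N) →
  pow1 uvar N *₁ evalU W ≋ pow1 uvar m *₁ concatMap (λ k → powU (+ k ℤ.- + m + + N)) W
evalU-shift N m [] _ = ≋-trans (*₁-zeroʳ (pow1 uvar N)) (≋-sym (*₁-zeroʳ (pow1 uvar m)))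
evalU-shift N m (k ∷ W) nonneg =
  ≋-trans (*₁-distribˡ-+₁ (pow1 uvar N) (pow1 uvar k) (evalU W))
  (≋-trans (+₁-cong (monomial (+ k ℤ.- + m + + N) (nonneg (here refl)) refl) (evalU-shift N m W (nonneg ∘ there)))
  (≋-sym (*₁-distribˡ-+₁ (pow1 uvar m) (powU (+ k ℤ.- + m + + N)) _)))
  where
  arith : ∀ k m N → N + k ≡ m + (k ℤ.- m + N)
  arith = solve-∀
  monomial : ∀ e → 0ℤ ℤ.≤ e → + k ℤ.- + m + + N ≡ e → pow1 uvar N *₁ pow1 uvar k ≋ pow1 uvar m *₁ powU e
  monomial (+ n) _ eq = ≋-trans (pow1-+ uvar N k) (≋-trans
    (≋-reflexive (cong (pow1 uvar) (ℤP.+-injective (trans (arith (+ k) (+ m) (+ N)) (cong (λ e → + m + e) eq)))))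
    (≋-sym (pow1-+ uvar m n)))
  monomial -[1+ _ ] ()

-- The top coefficient and the R-polynomials

module _ {m : ℕ} (i : Fin m) {v w : Perm (suc m)} (pv : Permutation v) (pw : Permutation w)
         (w-up : len (sL i w) ≡ suc (len w)) where

  private
    w≤sw = ≤B-sL-up i pw w-up
    ssw≤sw = subst (_≤B sL i w) (sym (sL-involutive i w)) w≤sw

  -- The lifting property: `sL i w` is an upper bound of both `w` and `sL i w`, hence by `≤B-upper`
  -- of `sL i v`. The next two lemmas argue dually, with `v` as the common lower bound.
  lift-image : v ≤B w → sL i v ≤B sL i w
  lift-image v≤w = ≤B-upper i pv v≤w w≤sw ≤B-refl

  lower-image : len (sL i v) ≡ suc (len v) → sL i v ≤B sL i w → v ≤B w
  lower-image v-up sv≤sw = subst (v ≤B_) (sL-involutive i w)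
    (≤B-lower i (sL-Permutation i pv) sv≤sw (≤B-sL-up i pv v-up) (subst (v ≤B_) (sym (sL-involutive i v)) ≤B-refl))

  lower-ascent : len (sL i v) ≡ suc (len v) → v ≤B sL i w → v ≤B w
  lower-ascent v-up v≤sw = subst (v ≤B_) (sL-involutive i w)
    (≤B-lower i pv v≤sw ≤B-refl (≤B-sL-up i pv v-up))

  module _ {R : Perm (suc m) → Perm (suc m) → LP1} (isRPoly : IsRPoly m R) where
    open IsRPoly isRPoly

    private
      ssw<sw : sL i (sL i w) <B sL i w
      ssw<sw = ssw≤sw , sL-≢ i (trans w-up (cong (suc ∘ len) (sym (sL-involutive i w))))

    R-image : len (sL i v) ≡ suc (len v) → v ≤B w → R (sL i v) (sL i w) ≋ R v w
    R-image v-up v≤w = subst₂ (λ x y → R (sL i v) (sL i w) ≋ R x y) (sL-involutive i v) (sL-involutive i w)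
      (coeffs (R-desc (sL i v) (sL i w) i (sL-Permutation i pv .distinct) (sL-Permutation i pw .distinct)
        (lift-image v≤w) ssw<sw
        ( subst (_≤B sL i v) (sym (sL-involutive i v)) (≤B-sL-up i pv v-up)
        , sL-≢ i (trans v-up (cong (suc ∘ len) (sym (sL-involutive i v)))))))

    R-ascent : len (sL i v) ≡ suc (len v) → v ≤B w →
      R v (sL i w) ≋ qMinus1 *₁ R v w +₁ qvar *₁ R (sL i v) w
    R-ascent v-up v≤w = ≋-trans
      (subst (λ x → R v (sL i w) ≋ qMinus1 *₁ R (sL i v) (sL i w) +₁ qvar *₁ R (sL i v) x) (sL-involutive i w)
        (coeffs (R-asc v (sL i w) i (pv .distinct) (sL-Permutation i pw .distinct) (≤B-trans v≤w w≤sw) ssw<sw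
          (≤B-sL-up i pv v-up , λ e → ℕP.1+n≢n (trans (sym v-up) (cong len (sym e)))))))
      -- The defining recursion has R_{sv}^{sw} where the skein recursion has R_v^w; the two agree
      -- by the descent case.
      (+₁-cong (*₁-cong {qMinus1} ≋-refl (R-image v-up v≤w)) ≋-refl)

module _ {m : ℕ} {R : Perm (suc m) → Perm (suc m) → LP1} (isRPoly : IsRPoly m R)
         {F : (k : ℕ) → List (Gen k) → LP2} (isHOMFLY : IsHOMFLY F) where
  open IsRPoly isRPoly
  open HOMFLY F isHOMFLY

  -- [a^κ] P_{v,w} = Σ_{k ∈ exponents} z^{k-m}; that its coefficients are nonnegative is what makes it
  -- nonzero for v ≤ w.
  record TopTerm (v w : Perm (suc m)) (top : ℤ → ℤ) : Set where
    field
      exponents : List ℕ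
      top-coeff : ∀ j → top j ≡ zCoeff m exponents j
      R-value : R v w ≋ mon1 (ℓvw v w) 1ℤ *₁ evalU exponents
      -- Carries a decision of `v ≤B w` through the induction, which selects between the recursion
      -- of R and `R-notle`.
      nonempty-iff-≤B : (v ≤B w × exponents ≢ []) ⊎ (¬ (v ≤B w) × exponents ≡ [])

  open TopTerm

  private
    topAt : ∀ rv rw → ℤ → ℤ
    topAt rv rw = coeffAt m (βvw rv rw) 0ℤ

  βvw-rotate : ∀ i rv (rw : List (Fin m)) d j →
    coeffAt m (σ⁻ i ∷ βvw rv rw) d j ≡ coeffAt m (posBraid rw ++ (invPosBraid rv ++ σ⁻ i ∷ [])) d j
  βvw-rotate i rv rw d j = trans (coeffAt-conj (σ⁻ i ∷ []) (βvw rv rw) d j)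
    (cong (λ x → coeffAt m x d j) (ListP.++-assoc (posBraid rw) (invPosBraid rv) (σ⁻ i ∷ [])))

  topAt-descent : ∀ {i rv rv′} rw → rv ∼ i ∷ rv′ → ∀ j → topAt rv (i ∷ rw) j ≡ topAt rv′ rw j
  topAt-descent {i} {rv} {rv′} rw e j = begin
    coeffAt m (σ⁺ i ∷ βvw rv rw) 0ℤ j
      ≡⟨ coeffAt-conj (σ⁺ i ∷ []) (βvw rv rw) 0ℤ j ⟩
    coeffAt m (βvw rv rw ++ σ⁺ i ∷ []) 0ℤ j
      ≡⟨ coeffAt-≃ (≃-trans (≃-reflexive (ListP.++-assoc (posBraid rw) (invPosBraid rv) (σ⁺ i ∷ [])))
          (≃-prepend (posBraid rw) (≃-trans (invPosBraid-snoc e (σ⁺ i ∷ []))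
            (≃-trans (≃-prepend (invPosBraid rv′) (≃-cancel⁻⁺ i [])) (≃-reflexive (ListP.++-identityʳ _)))))) 0ℤ j ⟩
    coeffAt m (βvw rv′ rw) 0ℤ j ∎
    where open ≡-Reasoning

  -- The skein relation at the leading letter σ_i. In its negative term the letter rotates to the
  -- end, where β(v)⁻¹ σ_i⁻¹ is the inverse of β(s_i v).
  topAt-ascent : ∀ {i rv rv′} rw → i ∷ rv ∼ rv′ → ∀ j →
    topAt rv (i ∷ rw) j ≡ topAt rv rw (j ℤ.- 1ℤ) + topAt rv′ rw j
  topAt-ascent {i} {rv} {rv′} rw e j = begin
    coeffAt m (σ⁺ i ∷ βvw rv rw) 0ℤ j                          ≡⟨ coeffAt-skein [] (βvw rv rw) i 0ℤ j ⟩
    coeffAt m (σ⁻ i ∷ βvw rv rw) 0ℤ j + topAt rv rw (j ℤ.- 1ℤ) ≡⟨ ℤP.+-comm _ (topAt rv rw (j ℤ.- 1ℤ)) ⟩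
    topAt rv rw (j ℤ.- 1ℤ) + coeffAt m (σ⁻ i ∷ βvw rv rw) 0ℤ j
      ≡⟨ cong (λ u → topAt rv rw (j ℤ.- 1ℤ) + u) (trans (βvw-rotate i rv rw 0ℤ j)
          (coeffAt-≃ (≃-prepend (posBraid rw) (≃-sym (≃-trans (≃-reflexive (sym (ListP.++-identityʳ _)))
            (invPosBraid-snoc (∼-sym e) [])))) 0ℤ j)) ⟩
    topAt rv rw (j ℤ.- 1ℤ) + topAt rv′ rw j                    ∎
    where open ≡-Reasoning

  topTerm-id : ∀ c → TopTerm (wordPerm (nf c)) (wordPerm []) (topAt (nf c) [])
  topTerm-id c with coeffAt-invPosBraid c
  ... | inj₁ e = subst (λ ws → TopTerm (wordPerm ws) (wordPerm []) (topAt ws [])) (sym e) (record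
    -- The unlink of m + 1 components: top coefficient z^{0-m}, and `evalU` gives 1 = R_1^1.
    { exponents = 0 ∷ []
    ; top-coeff = coeffAt-unlink m
    ; R-value = ≋-trans (coeffs (R-diag (idPerm (suc m)) (idPerm-Permutation (suc m) .distinct)))
        (≋-reflexive (cong (λ e → mon1 e 1ℤ *₁ one1) (sym (ℤP.+-inverseʳ (+ len (idPerm (suc m)))))))
    ; nonempty-iff-≤B = inj₁ (≤B-refl , λ ()) })
  ... | inj₂ (nonempty , vanish) = record
    { exponents = []
    ; top-coeff = vanish
    ; R-value = coeffs (R-notle _ _ (wordPerm-Permutation (nf c) .distinct) (idPerm-Permutation (suc m) .distinct) v≰id)
    ; nonempty-iff-≤B = inj₂ (v≰id , refl) }
    where
    v≰id : ¬ (wordPerm (nf c) ≤B idPerm (suc m))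
    v≰id le = nonempty (length-zero (nf c) (ℕP.n≤0⇒n≡0
      (subst₂ ℕ._≤_ (len-nf c) (len-idPerm (suc m)) (≤B-len le))))
      where
      length-zero : (ws : List (Fin m)) → length ws ≡ 0 → ws ≡ []
      length-zero [] _ = refl

  -- Phrased from the shorter pair upwards. Both lengths rise by one, so the power of t and the
  -- exponents carry over unchanged.
  topTerm-descent : ∀ {i v w top top′} → Permutation v → Permutation w → len (sL i v) ≡ suc (len v) →
    len (sL i w) ≡ suc (len w) → (∀ j → top′ j ≡ top j) → TopTerm v w top → TopTerm (sL i v) (sL i w) top′
  topTerm-descent {i} {v} {w} pv pw v-up w-up eq t = record
    { exponents = t .exponents
    ; top-coeff = λ j → trans (eq j) (t .top-coeff j)
    ; R-value = R-value′ (t .nonempty-iff-≤B)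
    ; nonempty-iff-≤B = iff (t .nonempty-iff-≤B) }
    where
    iff : (v ≤B w × t .exponents ≢ []) ⊎ (¬ (v ≤B w) × t .exponents ≡ []) →
      (sL i v ≤B sL i w × t .exponents ≢ []) ⊎ (¬ (sL i v ≤B sL i w) × t .exponents ≡ [])
    iff (inj₁ (v≤w , ne)) = inj₁ (lift-image i pv pw w-up v≤w , ne)
    iff (inj₂ (v≰w , e)) = inj₂ (v≰w ∘ lower-image i pv pw w-up v-up , e)
    ℓ-image : ℓvw v w ≡ ℓvw (sL i v) (sL i w)
    ℓ-image = trans (arith (+ len v) (+ len w)) (sym (cong₂ (λ a b → + a ℤ.- + b) w-up v-up))
      where
      arith : ∀ a b → b ℤ.- a ≡ (1ℤ + b) ℤ.- (1ℤ + a)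
      arith = solve-∀
    R-value′ : (v ≤B w × t .exponents ≢ []) ⊎ (¬ (v ≤B w) × t .exponents ≡ []) →
      R (sL i v) (sL i w) ≋ mon1 (ℓvw (sL i v) (sL i w)) 1ℤ *₁ evalU (t .exponents)
    R-value′ (inj₁ (v≤w , _)) = ≋-trans (R-image i pv pw w-up isRPoly v-up v≤w)
      (subst (λ ℓ → R v w ≋ mon1 ℓ 1ℤ *₁ evalU (t .exponents)) ℓ-image (t .R-value))
    R-value′ (inj₂ (v≰w , e)) = ≋-trans
      (coeffs (R-notle _ _ (sL-Permutation i pv .distinct) (sL-Permutation i pw .distinct)
        (v≰w ∘ lower-image i pv pw w-up v-up)))
      (≋-reflexive (cong (λ W → mon1 (ℓvw (sL i v) (sL i w)) 1ℤ *₁ evalU W) (sym e)))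

  -- The factor z becomes `map suc` and the sum becomes concatenation. Since v ≤ s_i v, a nonempty
  -- second list forces v ≤ w, so the first list alone decides whether the result is nonempty.
  topTerm-ascent : ∀ {i v w top₁ top₂ top} → Permutation v → Permutation w → len (sL i v) ≡ suc (len v) →
    len (sL i w) ≡ suc (len w) → (∀ j → top j ≡ top₁ (j ℤ.- 1ℤ) + top₂ j) →
    TopTerm v w top₁ → TopTerm (sL i v) w top₂ → TopTerm v (sL i w) top
  topTerm-ascent {i} {v} {w} pv pw v-up w-up eq t₁ t₂ = record
    { exponents = map suc W₁ ++ W₂
    ; top-coeff = λ j → trans (eq j) (trans
        (cong₂ _+_ (trans (t₁ .top-coeff (j ℤ.- 1ℤ)) (sym (zCoeff-shift {m} {m} {1ℤ} suc (λ k → arith (+ k) (+ m)) W₁ j)))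
          (t₂ .top-coeff j))
        (sym (zCoeff-++ m (map suc W₁) W₂ j)))
    ; R-value = R-value′ (t₁ .nonempty-iff-≤B) (t₂ .nonempty-iff-≤B)
    ; nonempty-iff-≤B = iff (t₁ .nonempty-iff-≤B) (t₂ .nonempty-iff-≤B) }
    where
    W₁ = t₁ .exponents
    W₂ = t₂ .exponents
    arith : ∀ k m → k ℤ.- m + 1ℤ ≡ (1ℤ + k) ℤ.- m
    arith = solve-∀
    v≤sv : v ≤B sL i v
    v≤sv = ≤B-sL-up i pv v-up
    iff : (v ≤B w × W₁ ≢ []) ⊎ (¬ (v ≤B w) × W₁ ≡ []) → (sL i v ≤B w × W₂ ≢ []) ⊎ (¬ (sL i v ≤B w) × W₂ ≡ []) →
      (v ≤B sL i w × map suc W₁ ++ W₂ ≢ []) ⊎ (¬ (v ≤B sL i w) × map suc W₁ ++ W₂ ≡ [])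
    iff (inj₁ (v≤w , ne)) _ = inj₁ (≤B-trans v≤w (≤B-sL-up i pw w-up) ,
      λ e → ne (ListP.map-injective ℕP.suc-injective (ListP.++-conicalˡ (map suc W₁) W₂ e)))
    iff (inj₂ (v≰w , _)) (inj₁ (sv≤w , _)) = contradiction (≤B-trans v≤sv sv≤w) v≰w
    iff (inj₂ (v≰w , e₁)) (inj₂ (_ , e₂)) = inj₂ (v≰w ∘ lower-ascent i pv pw w-up v-up ,
      cong₂ (λ A B → map suc A ++ B) e₁ e₂)
    ℓ = ℓvw v (sL i w)
    ℓ₁ : ℓvw v w ≡ ℓ + - 1ℤ
    ℓ₁ = trans (arith₁ (+ len v) (+ len w)) (cong (λ a → + a ℤ.- + len v + - 1ℤ) (sym w-up))
      where
      arith₁ : ∀ a b → b ℤ.- a ≡ (1ℤ + b) ℤ.- a + - 1ℤ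
      arith₁ = solve-∀
    ℓ₂ : ℓvw (sL i v) w ≡ ℓ + - + 2
    ℓ₂ = trans (cong (λ a → + len w ℤ.- + a) v-up)
      (trans (arith₂ (+ len v) (+ len w)) (cong (λ a → + a ℤ.- + len v + - + 2) (sym w-up)))
      where
      arith₂ : ∀ a b → b ℤ.- (1ℤ + a) ≡ (1ℤ + b) ℤ.- a + - + 2
      arith₂ = solve-∀
    R-value′ : (v ≤B w × W₁ ≢ []) ⊎ (¬ (v ≤B w) × W₁ ≡ []) → (sL i v ≤B w × W₂ ≢ []) ⊎ (¬ (sL i v ≤B w) × W₂ ≡ []) →
      R v (sL i w) ≋ mon1 ℓ 1ℤ *₁ evalU (map suc W₁ ++ W₂)
    R-value′ (inj₁ (v≤w , _)) _ = begin
      R v (sL i w)                                    ≈⟨ R-ascent i pv pw w-up isRPoly v-up v≤w ⟩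
      qMinus1 *₁ R v w +₁ qvar *₁ R (sL i v) w
        ≈⟨ +₁-cong (*₁-congˡ qMinus1 (subst (λ e → R v w ≋ mon1 e 1ℤ *₁ evalU W₁) ℓ₁ (t₁ .R-value)))
            (*₁-congˡ qvar (subst (λ e → R (sL i v) w ≋ mon1 e 1ℤ *₁ evalU W₂) ℓ₂ (t₂ .R-value))) ⟩
      qMinus1 *₁ (mon1 (ℓ + - 1ℤ) 1ℤ *₁ evalU W₁) +₁ qvar *₁ (mon1 (ℓ + - + 2) 1ℤ *₁ evalU W₂)
        ≈⟨ R-recursion ℓ (evalU W₁) (evalU W₂) ⟩
      mon1 ℓ 1ℤ *₁ (uvar *₁ evalU W₁ +₁ evalU W₂)
        ≈⟨ *₁-congˡ (mon1 ℓ 1ℤ) (≋-trans (+₁-cong (≋-sym (evalU-map-suc W₁)) ≋-refl)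
            (≋-reflexive (sym (evalU-++ (map suc W₁) W₂)))) ⟩
      mon1 ℓ 1ℤ *₁ evalU (map suc W₁ ++ W₂)           ∎
      where open ≋-Reasoning
    R-value′ (inj₂ (v≰w , _)) (inj₁ (sv≤w , _)) = contradiction (≤B-trans v≤sv sv≤w) v≰w
    R-value′ (inj₂ (v≰w , e₁)) (inj₂ (_ , e₂)) = ≋-trans
      (coeffs (R-notle _ _ (pv .distinct) (sL-Permutation i pw .distinct) (v≰w ∘ lower-ascent i pv pw w-up v-up)))
      (≋-reflexive (cong₂ (λ A B → mon1 ℓ 1ℤ *₁ evalU (map suc A ++ B)) (sym e₁) (sym e₂)))

  -- Recursion on the reduced word of w, for all codes of v at once, because the ascent case calls
  -- both v and s_i v.
  topTerm-nf : ∀ ws → length ws ≡ len (wordPerm ws) → ∀ c → TopTerm (wordPerm (nf c)) (wordPerm ws) (topAt (nf c) ws)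
  topTerm-nf [] _ c = topTerm-id c
  topTerm-nf (i ∷ ws) red c = by-step (step i c)
    where
    ws-red = reduced-tail i ws red
    perm-of : ∀ c → Permutation (wordPerm (nf c))
    perm-of c = wordPerm-Permutation (nf c)
    len-∼ : ∀ c c′ → nf c′ ∼ i ∷ nf c → len (sL i (wordPerm (nf c))) ≡ suc (len (wordPerm (nf c)))
    len-∼ c c′ e = begin
      len (sL i (wordPerm (nf c))) ≡⟨ cong len (sym (∼-wordPerm e)) ⟩
      len (wordPerm (nf c′))       ≡⟨ len-nf c′ ⟩
      length (nf c′)               ≡⟨ ∼-length e ⟩
      suc (length (nf c))          ≡⟨ cong suc (sym (len-nf c)) ⟩
      suc (len (wordPerm (nf c)))  ∎
      where open ≡-Reasoning
    w-up : len (sL i (wordPerm ws)) ≡ suc (len (wordPerm ws))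
    w-up = trans (sym red) (cong suc ws-red)
    by-step : Step i c → TopTerm (wordPerm (nf c)) (wordPerm (i ∷ ws)) (topAt (nf c) (i ∷ ws))
    by-step (up c′ e) = topTerm-ascent (perm-of c) (wordPerm-Permutation ws) (len-∼ c c′ (∼-sym e)) w-up
      (topAt-ascent ws e) (topTerm-nf ws ws-red c)
      (subst (λ v → TopTerm v (wordPerm ws) (topAt (nf c′) ws)) (sym (∼-wordPerm e)) (topTerm-nf ws ws-red c′))
    by-step (down c′ e) = subst (λ v → TopTerm v (wordPerm (i ∷ ws)) (topAt (nf c) (i ∷ ws))) (sym (∼-wordPerm e))
      (topTerm-descent (perm-of c′) (wordPerm-Permutation ws) (len-∼ c′ c e) w-up (topAt-descent ws e) (topTerm-nf ws ws-red c′))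

  topTerm-∼ : ∀ {rv rv′ rw v w} → rv ∼ rv′ → TopTerm v w (topAt rv′ rw) → TopTerm v w (topAt rv rw)
  topTerm-∼ {rw = rw} e t = record
    { exponents = t .exponents
    ; top-coeff = λ j → trans (coeffAt-≃ (≃-prepend (posBraid rw) (invPosBraid-resp-∼ e)) 0ℤ j) (t .top-coeff j)
    ; R-value = t .R-value
    ; nonempty-iff-≤B = t .nonempty-iff-≤B }

  topTerm : ∀ {v w} rv rw → IsReducedWord v rv → IsReducedWord w rw → TopTerm v w (topAt rv rw)
  topTerm rv rw (refl , rv-red) (refl , rw-red) with reduced-nf rv rv-red
  ... | c , e = topTerm-∼ e (subst (λ v → TopTerm v (wordPerm rw) (topAt (nf c) rw)) (sym (∼-wordPerm e))
                  (topTerm-nf rw rw-red c))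

  -- From the top coefficient to the three statements

  module _ {v w : Perm (suc m)} (rv rw : List (Fin m)) (v-red : IsReducedWord v rv) (w-red : IsReducedWord w rw) where
    private
      κ = kappa v w
      P = F m (βvw rv rw)

    -- The writhe of β(w)β(v)⁻¹ is ℓ(w) - ℓ(v), as the words are reduced; so κ is exactly the degree
    -- from which `coeffAt` counts.
    κ-writhe : κ ≡ + m ℤ.- writhe (βvw rv rw)
    κ-writhe = cong (λ e → + m ℤ.- e)
      (sym (trans (writhe-βvw rv rw) (cong₂ (λ a b → + a ℤ.- + b) (w-red .proj₂) (v-red .proj₂))))

    coeff2-κ : ∀ j → coeff2 P κ j ≡ topAt rv rw j
    coeff2-κ j = cong (λ i → coeff2 P i j) (trans κ-writhe (sym (ℤP.+-identityʳ _)))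

    coeff2-above-κ : ∀ i j → κ < i → coeff2 P i j ≡ 0ℤ
    coeff2-above-κ i j κ<i with i ℤ.- κ in eq | subst (_< i ℤ.- κ) (ℤP.+-inverseʳ κ) (ℤP.+-monoˡ-< (- κ) κ<i)
    ... | + zero | ℤ.+<+ ()
    ... | + suc d | _ = trans (cong (λ a → coeff2 P a j)
            (trans (split i κ) (cong₂ _+_ κ-writhe eq))) (bounded (βvw rv rw) d j)
      where
      split : ∀ i k → i ≡ k + (i ℤ.- k)
      split = solve-∀

    mdeg-lt : ¬ (v ≤B w) → MdegLt κ P
    mdeg-lt v≰w i j κ≤i with κ ℤ.≟ i | topTerm rv rw v-red w-red
    ... | no κ≢i | _ = coeff2-above-κ i j (ℤP.≤∧≢⇒< κ≤i κ≢i)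
    ... | yes refl | t with t .nonempty-iff-≤B
    ...   | inj₁ (v≤w , _) = contradiction v≤w v≰w
    ...   | inj₂ (_ , e) = trans (coeff2-κ j) (trans (t .top-coeff j) (cong (λ W → zCoeff m W j) e))

    mdeg-eq : v ≤B w → MdegEq κ P
    mdeg-eq v≤w = coeff2-above-κ , nonzero (topTerm rv rw v-red w-red)
      where
      nonzero : TopTerm v w (topAt rv rw) → ∃ λ j → coeff2 P κ j ≢ 0ℤ
      nonzero t with t .exponents | t .top-coeff | t .nonempty-iff-≤B
      ... | _ | _ | inj₂ (v≰w , _) = contradiction v≤w v≰w
      ... | [] | _ | inj₁ (_ , ne) = contradiction refl ne
      -- Any listed exponent would do; the first one contributes z^{k-m}.
      ... | k ∷ W | top | inj₁ _ = + k ℤ.- + m , λ z →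
              zCoeff-∈ {m} {k ∷ W} (here refl) (trans (sym (trans (coeff2-κ _) (top _))) z)

    R-top : ∀ N → (∀ j → j + + N < 0ℤ → coeff2 P κ j ≡ 0ℤ) →
      pow1 uvar N *₁ R v w ≋ mon1 (- κ) 1ℤ *₁ (pow1 qMinus1 m *₁ topSubst N κ P)
    R-top N vanish = begin
      pow1 uvar N *₁ R v w                                       ≈⟨ *₁-congˡ (pow1 uvar N) (t .R-value) ⟩
      pow1 uvar N *₁ (mon1 ℓ 1ℤ *₁ E)                            ≈⟨ x∙yz≈y∙xz (pow1 uvar N) (mon1 ℓ 1ℤ) E ⟩
      mon1 ℓ 1ℤ *₁ (pow1 uvar N *₁ E)
        ≈⟨ *₁-cong (≋-sym (mon1-* (- κ) (+ m) (arith (+ m) ℓ))) (≋-trans (evalU-shift N m W nonneg)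
            (*₁-congˡ (pow1 uvar m) (≋-sym (topSubst-zTerms N κ P {m} {W} top)))) ⟩
      (mon1 (- κ) 1ℤ *₁ mon1 (+ m) 1ℤ) *₁ (pow1 uvar m *₁ S)     ≈⟨ *₁-assoc (mon1 (- κ) 1ℤ) (mon1 (+ m) 1ℤ) _ ⟩
      mon1 (- κ) 1ℤ *₁ (mon1 (+ m) 1ℤ *₁ (pow1 uvar m *₁ S))
        ≈⟨ *₁-congˡ (mon1 (- κ) 1ℤ) (≋-sym (≋-trans (*₁-cong (pow1-qMinus1 m) (≋-refl {S}))
            (*₁-assoc (mon1 (+ m) 1ℤ) (pow1 uvar m) S))) ⟩
      mon1 (- κ) 1ℤ *₁ (pow1 qMinus1 m *₁ S)                     ∎
      where
      open ≋-Reasoning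
      t = topTerm rv rw v-red w-red
      W = t .exponents
      E = evalU W
      S = topSubst N κ P
      ℓ = ℓvw v w
      top : ∀ j → coeff2 P κ j ≡ zCoeff m W j
      top j = trans (coeff2-κ j) (t .top-coeff j)
      arith : ∀ m l → - (m ℤ.- l) + m ≡ l
      arith = solve-∀
      -- By positivity each listed `k` has a nonzero coefficient at z^{k-m}, so `vanish` excludes a
      -- negative k - m + N.
      nonneg : ∀ {k} → k ∈ W → 0ℤ ℤ.≤ + k ℤ.- + m + + N
      nonneg {k} k∈ = ℤP.≮⇒≥ λ neg → zCoeff-∈ {m} k∈ (trans (sym (top _)) (vanish (+ k ℤ.- + m) neg))

theorem2p1 : (m : ℕ) (R : Perm (suc m) → Perm (suc m) → LP1) → IsRPoly m R →
    (F : (k : ℕ) → List (Gen k) → LP2) → IsHOMFLY F →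
    (v w : Perm (suc m)) → IsPerm v → IsPerm w →
    (rv rw : List (Fin m)) → IsReducedWord v rv → IsReducedWord w rw →
    (¬ (v ≤B w) → MdegLt (kappa v w) (F m (βvw rv rw)))
    × (v ≤B w → MdegEq (kappa v w) (F m (βvw rv rw)))
    × ((N : ℕ) →
    (∀ j → j + + N < 0ℤ → coeff2 (F m (βvw rv rw)) (kappa v w) j ≡ 0ℤ) →
    pow1 uvar N *₁ R v w
    ≈₁ mon1 (- kappa v w) 1ℤ *₁ (pow1 qMinus1 m *₁ topSubst N (kappa v w) (F m (βvw rv rw))))
theorem2p1 m R isRPoly F isHOMFLY v w _ _ rv rw v-red w-red =
  mdeg-lt isRPoly isHOMFLY rv rw v-red w-red ,
  mdeg-eq isRPoly isHOMFLY rv rw v-red w-red ,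
  λ N vanish → R-top isRPoly isHOMFLY rv rw v-red w-red N vanish .at
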